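{- There is a constant $c$ such that for every binary string $x$ the plain stopping time complexity of $x$ differs by at most $c$ from the minimal plain Kolmogorov complexity of a program that enumerates some prefix-free set of binary strings containing $x$.
   Context: $\mathrm{C}(\cdot)$ denotes plain Kolmogorov complexity (with respect to a fixed optimal decompressor). Machines and programs are encoded by binary strings in a fixed standard effective way, so their plain complexity is defined up to an $O(1)$ additive term. Consider Turing machines $M$ with a one-directional read-only input tape with binary alphabet and a work tape (or several work tapes) with arbitrary alphabet. Initially the input head is to the left of the input, so it must move right before seeing the first input bit. For a binary string $x$ we say that $M$ stops at $x$ if $M$, started with $x$ on the input tape and empty work tape, reads all the bits of $x$ and stops without trying to read more bits. The plain stopping time complexity of $x$ is the minimal plain Kolmogorov complexity of a machine $M$ of this type that stops at $x$ (it is defined up to an $O(1)$ additive term). A set of binary strings is prefix-free if it does not contain a string and a proper prefix of that string at the same time. A program enumerates a set if it lists (computably, in some order, possibly never halting) exactly the elements of the set. -}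

module Defs where

open import Level using (Level; 0ℓ) renaming (suc to lsuc)
open import Data.Bool.Base using (Bool; true; false)
open import Data.Empty using (⊥; ⊥-elim)
open import Data.Fin.Base using (Fin; zero; toℕ)
open import Data.List.Base using (List; []; _∷_; [_]; _++_; _∷ʳ_; map; concatMap; cartesianProduct;
                                  cartesianProductWith; allFin; replicate; length; drop; head)
open import Data.List.Membership.Propositional using (_∈_)
open import Data.List.Relation.Binary.Prefix.Heterogeneous using (Prefix)
open import Data.Maybe.Base using (Maybe; just; nothing)
open import Data.Nat.Base using (ℕ; zero; suc; _+_; _≤_)
open import Data.Product.Base using (_×_; _,_; ∃-syntax)
open import Data.Vec.Base as Vec using (Vec)
open import Function.Bundles using (_⇔_)
open import Relation.Binary.Construct.Closure.ReflexiveTransitive using (Star)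
open import Relation.Binary.PropositionalEquality using (_≡_; _≢_)
open import Relation.Nullary.Negation.Core using (¬_)
open import Relation.Unary using (Pred)

private variable
  ℓ : Level
  A Γ : Set

BitString : Set
BitString = List Bool

data Move : Set where
  left stay right : Move

record Action (Γ : Set) (states symbols tapes : ℕ) : Set where
  constructor action
  field
    next    : Fin states
    advance : Bool                            -- move the input head right?
    output  : Maybe Γ
    work    : Vec (Fin symbols × Move) tapes

-- A deterministic Turing machine with one or more work tapes, a one-way
-- read-only binary input tape and a one-way write-only output tape over Γ.
-- Γ = ⊥ means that there is no output tape.  State zero is initial and symbol
-- zero is the blank.  The second argument of δ is the input cell under the head,
-- with `nothing` for a cell outside the input.  The machine halts when δ returns
-- `nothing`.

record Machine (Γ : Set) : Set where
  field
    states-1 symbols-1 tapes-1 : ℕ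
    δ : Fin (suc states-1) → Maybe Bool → Vec (Fin (suc symbols-1)) (suc tapes-1) →
        Maybe (Action Γ (suc states-1) (suc symbols-1) (suc tapes-1))

  states symbols tapes : ℕ
  states  = suc states-1
  symbols = suc symbols-1
  tapes   = suc tapes-1

  State Symbol Command : Set
  State   = Fin states
  Symbol  = Fin symbols
  Command = Action Γ states symbols tapes

-- A two-way infinite tape, blank outside the listed cells.  The list before
-- the scanned cell is stored nearest cell first.

record Tape (S : Set) : Set where
  constructor tape
  field
    before  : List S
    scanned : S
    after   : List S

moveHead : {S : Set} → S → Move → Tape S → Tape S
moveHead blank left  (tape []       s rs)       = tape [] blank (s ∷ rs)
moveHead blank left  (tape (l ∷ ls) s rs)       = tape ls l (s ∷ rs)
moveHead blank stay  t                          = t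
moveHead blank right (tape ls       s [])       = tape (s ∷ ls) blank []
moveHead blank right (tape ls       s (r ∷ rs)) = tape (s ∷ ls) r rs

-- Position zero is to the left of the input; position i ≥ 1 is the i-th bit.

inputCell : BitString → ℕ → Maybe Bool
inputCell x zero    = nothing
inputCell x (suc i) = head (drop i x)

module Run (M : Machine Γ) where
  open Machine M

  record Config : Set where
    constructor config
    field
      state    : State
      position : ℕ
      written  : List Γ
      memory   : Vec (Tape Symbol) tapes

  open Config public

  initial : Config
  initial = config zero 0 [] (Vec.replicate tapes (tape [] zero []))

  decision : BitString → Config → Maybe Command
  decision x c = δ (state c) (inputCell x (position c)) (Vec.map Tape.scanned (memory c))

  advanced : Bool → ℕ → ℕ
  advanced true  i = suc i
  advanced false i = i

  appended : Maybe Γ → List Γ → List Γ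
  appended nothing  w = w
  appended (just g) w = w ∷ʳ g

  operate : Symbol × Move → Tape Symbol → Tape Symbol
  operate (s , m) (tape ls _ rs) = moveHead zero m (tape ls s rs)

  perform : Command → Config → Config
  perform (action q a o w) (config _ i out ts) =
    config q (advanced a i) (appended o out) (Vec.zipWith operate w ts)

  Step : BitString → Config → Config → Set
  Step x c d = ∃[ a ] decision x c ≡ just a × d ≡ perform a c

  Reachable : BitString → Config → Set
  Reachable x = Star (Step x) initial

  Halted : BitString → Config → Set
  Halted x c = decision x c ≡ nothing

-- A machine is encoded by its numbers of tapes, symbols and states, followed by
-- the table of δ.  All codes of components are self-delimiting.

unary : ℕ → BitString
unary n = replicate n true ∷ʳ false

maybeCode : (A → BitString) → Maybe A → BitString
maybeCode code nothing  = [ false ]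
maybeCode code (just a) = true ∷ code a

moveCode : Move → BitString
moveCode stay  = [ false ]
moveCode left  = true ∷ false ∷ []
moveCode right = true ∷ true ∷ []

vectors : List A → (n : ℕ) → List (Vec A n)
vectors as zero    = [ Vec.[] ]
vectors as (suc n) = cartesianProductWith Vec._∷_ as (vectors as n)

module Encoding (code : Γ → BitString) (M : Machine Γ) where
  open Machine M

  finCode : ∀ {n} → Fin n → BitString
  finCode i = unary (toℕ i)

  workCode : Symbol × Move → BitString
  workCode (s , m) = finCode s ++ moveCode m

  actionCode : Command → BitString
  actionCode (action q a o w) =
    finCode q ++ [ a ] ++ maybeCode code o ++ concatMap workCode (Vec.toList w)

  situations : List (State × Maybe Bool × Vec Symbol tapes)
  situations = cartesianProduct (allFin states)
                 (cartesianProduct (nothing ∷ just false ∷ just true ∷ [])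
                   (vectors (allFin symbols) tapes))

  rowCode : State × Maybe Bool × Vec Symbol tapes → BitString
  rowCode (q , b , ss) =
    finCode q ++ maybeCode [_] b ++ concatMap finCode (Vec.toList ss)
      ++ maybeCode actionCode (δ q b ss)

  machineCode : BitString
  machineCode = unary tapes ++ unary symbols ++ unary states ++ concatMap rowCode situations

-- Decompressors: partial computable functions on binary strings.

Decompressor : Set
Decompressor = Machine Bool

Decompresses : Decompressor → BitString → BitString → Set
Decompresses D p y = ∃[ c ] Reachable p c × Halted p c × written c ≡ y
  where open Run D

Optimal : Decompressor → Set
Optimal U = (D : Decompressor) → ∃[ c ] (∀ p y → Decompresses D p y →
              ∃[ q ] Decompresses U q y × length q ≤ length p + c)

IsMinimum : Pred ℕ ℓ → Pred ℕ ℓ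
IsMinimum P n = P n × (∀ m → P m → n ≤ m)

-- C(y) = n; complexities are relations because a minimum need not be computable.

PlainComplexity : Decompressor → BitString → ℕ → Set
PlainComplexity U y = IsMinimum (λ n → ∃[ p ] Decompresses U p y × length p ≡ n)

-- Stopping machines.  As the input head never moves back, a run ending on the
-- last bit of x (or to the left of x, if x is empty) has never tried to read
-- beyond x.

Stopper : Set
Stopper = Machine ⊥

stopperCode : Stopper → BitString
stopperCode = Encoding.machineCode ⊥-elim

StopsAt : Stopper → BitString → Set
StopsAt M x = ∃[ c ] Reachable x c × Halted x c × position c ≡ length x
  where open Run M

StoppingComplexity : Decompressor → BitString → ℕ → Set
StoppingComplexity U x =
  IsMinimum (λ n → ∃[ M ] StopsAt M x × PlainComplexity U (stopperCode M) n)

-- Enumerating programs: machines run on no input that list strings on the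
-- output tape, each terminated by the separator `nothing`.

Enumerator : Set
Enumerator = Machine (Maybe Bool)

enumeratorCode : Enumerator → BitString
enumeratorCode = Encoding.machineCode (maybeCode [_])

-- The terminated strings on an output tape; the first argument is the part of
-- the current string already passed.

terminated : BitString → List (Maybe Bool) → List BitString
terminated u []            = []
terminated u (just b ∷ o)  = terminated (u ∷ʳ b) o
terminated u (nothing ∷ o) = u ∷ terminated [] o

Lists : Enumerator → BitString → Set
Lists E x = ∃[ c ] Reachable [] c × x ∈ terminated [] (written c)
  where open Run E

Enumerates : Enumerator → Pred BitString 0ℓ → Set
Enumerates E S = ∀ x → Lists E x ⇔ S x

PrefixFree : Pred BitString 0ℓ → Set
PrefixFree S = ∀ u v → S u → S v → ¬ (Prefix _≡_ u v × u ≢ v)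

PrefixFreeEnumerationComplexity : Decompressor → BitString → ℕ → Set (lsuc 0ℓ)
PrefixFreeEnumerationComplexity U x =
  IsMinimum (λ n → ∃[ E ] (∃[ S ] Enumerates E S × PrefixFree S × S x)
                     × PlainComplexity U (enumeratorCode E) n)

{-# OPTIONS --safe #-}

-- Both inequalities have the same form: an arbitrary machine M is replaced by a machine
-- that carries an optimal description q of M, decompresses it, and interprets the code so
-- obtained.  The code of the new machine is computed from q by a fixed decompressor, so
-- optimality bounds its complexity by |q| plus a constant.
--
-- From a stopping machine M to an enumerator: for every string w, run U on q and then M on
-- input w, both for |w| steps; if M halts having read the first p bits of w, list them.
-- The strings at which M stops form a prefix-free set because the head never moves back.
--
-- From an enumerator E of a prefix-free set to a stopping machine: having read u, run E
-- until it lists an extension v of u; stop if v = u and read one more bit otherwise.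
-- On an input x in the set no bit beyond x is read, since a listed proper extension of x
-- would contradict prefix-freeness.
--
-- These machines are obtained by compiling a small total language of list functions: a
-- value is serialised on one tape used as a stack, and a fixed driver loop feeds the
-- scanned input cell to the compiled function and obeys its answer.

module Submission where

open import Defs
open import Data.Bool.Base using (Bool; true; false; if_then_else_; not)
open import Data.Empty using (⊥-elim; ⊥)
open import Data.Fin.Base using (Fin; zero; suc; _↑ˡ_; _↑ʳ_; splitAt; toℕ)
open import Data.Fin.Patterns using (0F; 1F; 2F; 3F)
open import Data.Fin.Properties using (splitAt-↑ˡ; splitAt-↑ʳ; toℕ-↑ˡ; toℕ-↑ʳ; toℕ-injective)
open import Data.List.Base using (List; []; _∷_; _∷ʳ_; foldl; _++_; length; concatMap; [_]; _ʳ++_;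
  map; tabulate; allFin; cartesianProduct; reverse; replicate; drop; head)
open import Data.List.Membership.Propositional using (_∈_; _∉_)
open import Data.List.Membership.Propositional.Properties using (∈-cartesianProduct⁺;
  ∈-cartesianProductWith⁺; ∈-allFin; ∈-++⁻; ∈-++⁺ʳ)
open import Data.List.Properties using (foldl-++; ++-assoc; ++-identityʳ; concatMap-++;
  concatMap-map; concatMap-cong; foldl-cong; ʳ++-defn; reverse-involutive; length-++; ++-cancelˡ;
  map-++; drop-[]; reverse-++; length-replicate)
open import Data.List.Relation.Binary.Prefix.Heterogeneous using (Prefix; []; _∷_)
open import Data.List.Relation.Unary.Any using (here; there)
open import Data.Maybe.Base using (Maybe; just; nothing)
open import Data.Nat.Base using (ℕ; zero; suc; _+_; _≤_; z≤n; s≤s; _⊔_; _<_; ∣_-_∣)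
open import Data.Nat.Induction using (<-rec)
open import Data.Nat.Properties using (+-suc; +-comm; +-identityʳ; ≤-trans; ≤-refl; +-mono-≤;
  n≤1+n; ≤-reflexive; m≤m⊔n; m≤n⊔m; m≤n+m; +-cancelˡ-≡; <⇒≤; ≰⇒>; _≤?_; ≤-total; +-monoʳ-≤;
  m≤n⇒∣m-n∣≡n∸m; m≤n⇒∣n-m∣≡n∸m; m≤n+o⇒m∸n≤o)
open import Data.Product.Base using (Σ; _×_; _,_; proj₁; proj₂; ∃-syntax)
open import Data.Sum.Base using (_⊎_; inj₁; inj₂; [_,_]′)
open import Data.Unit.Base using (⊤; tt)
open import Data.Vec.Base as Vec using (Vec; []; _∷_)
open import Function.Base using (_∘_; id)
open import Function.Bundles using (Equivalence; mk⇔)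
open import Level using (0ℓ)
open import Relation.Binary.Construct.Closure.ReflexiveTransitive using (Star; ε; _◅_; _◅◅_)
open import Relation.Binary.PropositionalEquality using (_≡_; refl; sym; trans; cong; subst; cong₂;
  module ≡-Reasoning; _≢_)
open import Relation.Nullary.Decidable.Core using (yes; no; decidable-stable)
open import Relation.Nullary.Negation.Core using (¬_)
open import Relation.Unary using (Pred)

-- Fragments of control and their execution

-- The way complexity is measured dictates the shape of the new machine: its whole transition table
-- must be a computable function of q. Hence q is not compiled into control; a chain of loader
-- states pushes it onto a stack and hands over to a driver that is the same for every q. Since the
-- loader is numbered after the driver, no state number of the driver depends on q, and apart from
-- the count of states the table is a constant text followed by one that a single fold generates.
-- Compiled functions are total, so unbounded search is left to the driver loop: simulations are cut
-- off by clocks, which are bit strings of which only the length counts, and failures are repeated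
-- with longer clocks. The last obstacle is constructive. Complexities are minima, and a description
-- of the new machine only shows that its complexity cannot fail to exist. As the inequality aimed
-- at is decidable, and so stable under double negation, this is enough.

record Finite (S : Set) : Set where
  field
    count      : ℕ
    index      : S → Fin count
    from       : Fin count → S
    from-index : ∀ s → from (index s) ≡ s

open Finite

finite-⊤ : Finite ⊤
finite-⊤ .count = 1
finite-⊤ .index _ = zero
finite-⊤ .from _ = tt
finite-⊤ .from-index _ = refl

finite-⊎ : {S T : Set} → Finite S → Finite T → Finite (S ⊎ T)
finite-⊎ f g .count = count f + count g
finite-⊎ f g .index (inj₁ s) = index f s ↑ˡ count g
finite-⊎ f g .index (inj₂ t) = count f ↑ʳ index g t
finite-⊎ f g .from i = [ inj₁ ∘ from f , inj₂ ∘ from g ]′ (splitAt (count f) i)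
finite-⊎ f g .from-index (inj₁ s)
  rewrite splitAt-↑ˡ (count f) (index f s) (count g) = cong inj₁ (from-index f s)
finite-⊎ f g .from-index (inj₂ t)
  rewrite splitAt-↑ʳ (count f) (count g) (index g t) = cong inj₂ (from-index g t)

finite-Σ : ∀ n {S : Fin n → Set} → (∀ k → Finite (S k)) → Finite (Σ (Fin n) S)
finite-Σ zero f .count = 0
finite-Σ zero f .index (() , _)
finite-Σ zero f .from ()
finite-Σ zero f .from-index (() , _)
finite-Σ (suc n) {S} f = retract
  where
  both : Finite (S zero ⊎ Σ (Fin n) (S ∘ suc))
  both = finite-⊎ (f zero) (finite-Σ n (f ∘ suc))

  split : Σ (Fin (suc n)) S → S zero ⊎ Σ (Fin n) (S ∘ suc)
  split (zero , s) = inj₁ s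
  split (suc k , s) = inj₂ (k , s)

  merge : S zero ⊎ Σ (Fin n) (S ∘ suc) → Σ (Fin (suc n)) S
  merge (inj₁ s) = zero , s
  merge (inj₂ (k , s)) = suc k , s

  merge-split : ∀ s → merge (split s) ≡ s
  merge-split (zero , s) = refl
  merge-split (suc k , s) = refl

  retract : Finite (Σ (Fin (suc n)) S)
  retract .count = count both
  retract .index s = index both (split s)
  retract .from i = merge (from both i)
  retract .from-index s = trans (cong merge (from-index both (split s))) (merge-split s)

-- The two proper symbols spell binary trees in preorder. The blank marks the bottom of a stack: a
-- head that moves left of the listed cells scans a blank.
Sym : Set
Sym = Fin 3

pattern blank = zero
pattern leafSym = suc zero
pattern nodeSym = suc (suc zero)

-- These two repeat `advanced` and `appended` without reference to a machine, as fragments are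
-- executed before any machine is assembled from them; `perform-command` identifies the versions.
advancedTo : Bool → ℕ → ℕ
advancedTo true  i = suc i
advancedTo false i = i

appendedTo : {Γ : Set} → Maybe Γ → List Γ → List Γ
appendedTo nothing  w = w
appendedTo (just g) w = w ∷ʳ g

module Fragments (Γ : Set) where

  record Act : Set where
    constructor act
    field
      advance : Bool
      output  : Maybe Γ
      work    : Vec (Sym × Move) 4

  record World : Set where
    constructor world
    field
      position : ℕ
      written  : List Γ
      memory   : Vec (Tape Sym) 4

  operateOn : Sym × Move → Tape Sym → Tape Sym
  operateOn (s , m) (tape ls _ rs) = moveHead zero m (tape ls s rs)

  effect : Act → World → World
  effect (act a o w) (world i out ts) =
    world (advancedTo a i) (appendedTo o out) (Vec.zipWith operateOn w ts)

  -- The exits play the role of return values, so fragments compose by a bind, and `loop` spends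
  -- exit zero on the jump back to the entry.
  record Frag (n : ℕ) : Set₁ where
    no-eta-equality
    field
      State  : Set
      finite : Finite State
      entry  : State
      δ      : State → Maybe Bool → Vec Sym 4 → Act × (State ⊎ Fin n)

  open Frag

  idle : Vec (Sym × Move) 4
  idle = Vec.replicate 4 (blank , stay)

  waiting : Act
  waiting = act false nothing idle

  pushing : Fin 4 → Sym → Act
  pushing i a = act false nothing (idle Vec.[ i ]≔ (a , right))

  single : ∀ {n} → (Maybe Bool → Vec Sym 4 → Act × Fin n) → Frag n
  single f .State = ⊤
  single f .finite = finite-⊤
  single f .entry = tt
  single f .δ _ b ss = proj₁ (f b ss) , inj₂ (proj₂ (f b ss))

  skip : ∀ {n} → Fin n → Frag n
  skip k = single (λ _ _ → waiting , k)

  perform : Bool → Maybe Γ → Frag 1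
  perform a o = single (λ _ _ → act a o idle , zero)

  cellExit : Maybe Bool → Fin 3
  cellExit nothing      = 0F
  cellExit (just false) = 1F
  cellExit (just true)  = 2F

  look : Frag 3
  look = single (λ b _ → waiting , cellExit b)

  -- The list `before` of a tape serves as a stack, so a push is one move to the
  -- right; the scanned cell and the cells after it are irrelevant.
  push : Fin 4 → Sym → Frag 1
  push i a = single (λ _ _ → pushing i a , zero)

  -- The head rests on the cell after the top of the stack, so it has to move in one state and
  -- inspect in a second one.
  pop : Fin 4 → Frag 3
  pop i .State = ⊤ ⊎ ⊤
  pop i .finite = finite-⊎ finite-⊤ finite-⊤
  pop i .entry = inj₁ tt
  pop i .δ (inj₁ _) _ _ = act false nothing (idle Vec.[ i ]≔ (blank , left)) , inj₁ (inj₂ tt)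
  pop i .δ (inj₂ _) _ ss = waiting , inj₂ (Vec.lookup ss i)

  bindExit : ∀ {S : Set} {n m} (G : Fin n → Frag m) → Act × (S ⊎ Fin n) →
             Act × ((S ⊎ Σ (Fin n) (State ∘ G)) ⊎ Fin m)
  bindExit G (a , inj₁ s) = a , inj₁ (inj₁ s)
  bindExit G (a , inj₂ k) = a , inj₁ (inj₂ (k , entry (G k)))

  innerExit : ∀ {S T : Set} {n} → (S → T) → Act × (S ⊎ Fin n) → Act × (T ⊎ Fin n)
  innerExit f (a , inj₁ s) = a , inj₁ (f s)
  innerExit f (a , inj₂ k) = a , inj₂ k

  infixl 1 _>>=_ _>>_

  _>>=_ : ∀ {n m} → Frag n → (Fin n → Frag m) → Frag m
  (F >>= G) .State = State F ⊎ Σ _ (State ∘ G)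
  (F >>= G) .finite = finite-⊎ (finite F) (finite-Σ _ (finite ∘ G))
  (F >>= G) .entry = inj₁ (entry F)
  (F >>= G) .δ (inj₁ s) b ss = bindExit G (δ F s b ss)
  (F >>= G) .δ (inj₂ (k , s)) b ss = innerExit (λ s′ → inj₂ (k , s′)) (δ (G k) s b ss)

  _>>_ : ∀ {n} → Frag 1 → Frag n → Frag n
  F >> G = F >>= λ _ → G

  loopExit : ∀ {S : Set} {n} → S → Act × (S ⊎ Fin (suc n)) → Act × (S ⊎ Fin n)
  loopExit e (a , inj₁ s)       = a , inj₁ s
  loopExit e (a , inj₂ zero)    = a , inj₁ e
  loopExit e (a , inj₂ (suc k)) = a , inj₂ k

  loop : ∀ {n} → Frag (suc n) → Frag n
  loop F .State = State F
  loop F .finite = finite F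
  loop F .entry = entry F
  loop F .δ s b ss = loopExit (entry F) (δ F s b ss)

  module Exec (x : BitString) where

    at : ∀ {n} (F : Frag n) → State F → World → Act × (State F ⊎ Fin n)
    at F s (world i _ ts) = δ F s (inputCell x i) (Vec.map Tape.scanned ts)

    data Runs {n} (F : Frag n) : State F → World → Fin n → World → Set where
      done : ∀ {s μ a k} → at F s μ ≡ (a , inj₂ k) → Runs F s μ k (effect a μ)
      more : ∀ {s μ a s′ k ν} → at F s μ ≡ (a , inj₁ s′) → Runs F s′ (effect a μ) k ν →
             Runs F s μ k ν

    module _ {n m} {F : Frag n} {G : Fin n → Frag m} where

      runs-inner : ∀ {k s μ l ν} → Runs (G k) s μ l ν → Runs (F >>= G) (inj₂ (k , s)) μ l ν
      runs-inner {k} (done e) = done (cong (innerExit (λ s′ → inj₂ (k , s′))) e)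
      runs-inner {k} (more e r) =
        more (cong (innerExit (λ s′ → inj₂ (k , s′))) e) (runs-inner r)

      runs-bind : ∀ {s μ k ν l ξ} → Runs F s μ k ν → Runs (G k) (entry (G k)) ν l ξ →
                  Runs (F >>= G) (inj₁ s) μ l ξ
      runs-bind (done e)   r = more (cong (bindExit G) e) (runs-inner r)
      runs-bind (more e q) r = more (cong (bindExit G) e) (runs-bind q r)

    module _ {n} {F : Frag (suc n)} where

      runs-again : ∀ {s μ ν l ξ} → Runs F s μ zero ν → Runs (loop F) (entry F) ν l ξ →
                   Runs (loop F) s μ l ξ
      runs-again (done e)   r = more (cong (loopExit (entry F)) e) r
      runs-again (more e q) r = more (cong (loopExit (entry F)) e) (runs-again q r)

      runs-break : ∀ {s μ k ν} → Runs F s μ (suc k) ν → Runs (loop F) s μ k ν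
      runs-break (done e)   = done (cong (loopExit (entry F)) e)
      runs-break (more e q) = more (cong (loopExit (entry F)) e) (runs-break q)

    -- Nonempty executions that stay inside the fragment. The driver of an enumerator never exits,
    -- so its rounds are followed as paths from one loop head to the next; that each path takes a
    -- step is what makes `reaches-invariant` terminate.
    data Path {n} (F : Frag n) : State F → World → State F → World → Set where
      last : ∀ {s μ a t} → at F s μ ≡ (a , inj₁ t) → Path F s μ t (effect a μ)
      more : ∀ {s μ a s′ t ν} → at F s μ ≡ (a , inj₁ s′) → Path F s′ (effect a μ) t ν →
             Path F s μ t ν

    module _ {n m} {F : Frag n} {G : Fin n → Frag m} where

      path-inner : ∀ {k s μ t ν} → Path (G k) s μ t ν →
                   Path (F >>= G) (inj₂ (k , s)) μ (inj₂ (k , t)) ν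
      path-inner {k} (last e) = last (cong (innerExit (λ s′ → inj₂ (k , s′))) e)
      path-inner {k} (more e r) =
        more (cong (innerExit (λ s′ → inj₂ (k , s′))) e) (path-inner r)

      path-bind : ∀ {s μ k ν} → Runs F s μ k ν →
                  Path (F >>= G) (inj₁ s) μ (inj₂ (k , entry (G k))) ν
      path-bind (done e)   = last (cong (bindExit G) e)
      path-bind (more e q) = more (cong (bindExit G) e) (path-bind q)

    path-again : ∀ {n} {F : Frag (suc n)} {s μ ν} → Runs F s μ zero ν →
                 Path (loop F) s μ (entry F) ν
    path-again {F = F} (done e)   = last (cong (loopExit (entry F)) e)
    path-again {F = F} (more e q) = more (cong (loopExit (entry F)) e) (path-again q)

    record Stacks : Set where
      constructor stacks
      field
        position  : ℕ
        written   : List Γ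
        s₀ s₁ s₂ s₃ : List Sym

    view : World → Stacks
    view (world i o (t₀ ∷ t₁ ∷ t₂ ∷ t₃ ∷ [])) =
      stacks i o (Tape.before t₀) (Tape.before t₁) (Tape.before t₂) (Tape.before t₃)

    view-position : ∀ {μ i o a b c d} → view μ ≡ stacks i o a b c d → World.position μ ≡ i
    view-position {world _ _ (_ ∷ _ ∷ _ ∷ _ ∷ [])} refl = refl

    view-written : ∀ {μ i o a b c d} → view μ ≡ stacks i o a b c d → World.written μ ≡ o
    view-written {world _ _ (_ ∷ _ ∷ _ ∷ _ ∷ [])} refl = refl

    top : List Sym → Sym
    top []      = blank
    top (s ∷ _) = s

    rest : List Sym → List Sym
    rest []       = []
    rest (_ ∷ ss) = ss

    update : Fin 4 → (List Sym → List Sym) → Stacks → Stacks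
    update 0F f (stacks i o a b c d) = stacks i o (f a) b c d
    update 1F f (stacks i o a b c d) = stacks i o a (f b) c d
    update 2F f (stacks i o a b c d) = stacks i o a b (f c) d
    update 3F f (stacks i o a b c d) = stacks i o a b c (f d)

    stack : Fin 4 → Stacks → List Sym
    stack 0F = Stacks.s₀
    stack 1F = Stacks.s₁
    stack 2F = Stacks.s₂
    stack 3F = Stacks.s₃

    infix 0 _⊢_⇒_∣_
    -- All worlds with the view w are covered, because the scanned cells and the cells after them
    -- hold leftovers of earlier operations.
    record _⊢_⇒_∣_ {n} (F : Frag n) (w : Stacks) (k : Fin n) (w′ : Stacks) : Set where
      field
        run : ∀ μ → view μ ≡ w → ∃[ ν ] Runs F (entry F) μ k ν × view ν ≡ w′

    open _⊢_⇒_∣_ public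

    waiting-view : ∀ μ → view (effect waiting μ) ≡ view μ
    waiting-view (world i o (_ ∷ _ ∷ _ ∷ _ ∷ [])) = refl

    skip-spec : ∀ {n} {k : Fin n} {w} → skip k ⊢ w ⇒ k ∣ w
    skip-spec .run (world i o (_ ∷ _ ∷ _ ∷ _ ∷ [])) e = _ , done refl , e

    perform-spec : ∀ {a o i w s₀ s₁ s₂ s₃} →
                   perform a o ⊢ stacks i w s₀ s₁ s₂ s₃ ⇒ zero
                     ∣ stacks (advancedTo a i) (appendedTo o w) s₀ s₁ s₂ s₃
    perform-spec .run (world _ _ (_ ∷ _ ∷ _ ∷ _ ∷ [])) refl = _ , done refl , refl

    look-spec : ∀ {w} → look ⊢ w ⇒ cellExit (inputCell x (Stacks.position w)) ∣ w
    look-spec .run (world i o (_ ∷ _ ∷ _ ∷ _ ∷ [])) refl = _ , done refl , refl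

    private
      before-right : ∀ {a : Sym} t → Tape.before (operateOn (a , right) t) ≡ a ∷ Tape.before t
      before-right (tape ls s [])       = refl
      before-right (tape ls s (r ∷ rs)) = refl

      before-left : ∀ {a : Sym} t → Tape.before (operateOn (a , left) t) ≡ rest (Tape.before t)
      before-left (tape [] s rs)       = refl
      before-left (tape (l ∷ ls) s rs) = refl

      scanned-left : ∀ {a : Sym} t → Tape.scanned (operateOn (a , left) t) ≡ top (Tape.before t)
      scanned-left (tape [] s rs)       = refl
      scanned-left (tape (l ∷ ls) s rs) = refl

    push-view : ∀ i {a} μ → view (effect (pushing i a) μ) ≡ update i (a ∷_) (view μ)
    push-view 0F (world _ _ (t ∷ _ ∷ _ ∷ _ ∷ [])) =
      cong (λ z → stacks _ _ z _ _ _) (before-right t)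
    push-view 1F (world _ _ (_ ∷ t ∷ _ ∷ _ ∷ [])) =
      cong (λ z → stacks _ _ _ z _ _) (before-right t)
    push-view 2F (world _ _ (_ ∷ _ ∷ t ∷ _ ∷ [])) =
      cong (λ z → stacks _ _ _ _ z _) (before-right t)
    push-view 3F (world _ _ (_ ∷ _ ∷ _ ∷ t ∷ [])) =
      cong (λ z → stacks _ _ _ _ _ z) (before-right t)

    push-spec : ∀ i {a w} → push i a ⊢ w ⇒ zero ∣ update i (a ∷_) w
    push-spec i .run μ refl = _ , done refl , push-view i μ

    pop-spec : ∀ i {w} → pop i ⊢ w ⇒ top (stack i w) ∣ update i rest w
    pop-spec 0F .run (world _ _ (t ∷ _ ∷ _ ∷ _ ∷ [])) refl =
      _ , more refl (done (cong (λ z → waiting , inj₂ z) (scanned-left {blank} t)))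
        , cong (λ z → stacks _ _ z _ _ _) (before-left {blank} t)
    pop-spec 1F .run (world _ _ (_ ∷ t ∷ _ ∷ _ ∷ [])) refl =
      _ , more refl (done (cong (λ z → waiting , inj₂ z) (scanned-left {blank} t)))
        , cong (λ z → stacks _ _ _ z _ _) (before-left {blank} t)
    pop-spec 2F .run (world _ _ (_ ∷ _ ∷ t ∷ _ ∷ [])) refl =
      _ , more refl (done (cong (λ z → waiting , inj₂ z) (scanned-left {blank} t)))
        , cong (λ z → stacks _ _ _ _ z _) (before-left {blank} t)
    pop-spec 3F .run (world _ _ (_ ∷ _ ∷ _ ∷ t ∷ [])) refl =
      _ , more refl (done (cong (λ z → waiting , inj₂ z) (scanned-left {blank} t)))
        , cong (λ z → stacks _ _ _ _ _ z) (before-left {blank} t)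

    infixr 1 _»_
    _»_ : ∀ {n m} {F : Frag n} {G : Fin n → Frag m} {w k w′ l w″} →
                F ⊢ w ⇒ k ∣ w′ → G k ⊢ w′ ⇒ l ∣ w″ → F >>= G ⊢ w ⇒ l ∣ w″
    (p » q) .run μ e with p .run μ e
    ... | ν , r , f with q .run ν f
    ... | ξ , s , g = ξ , runs-bind r s , g

    again-spec : ∀ {n} {F : Frag (suc n)} {w w′ l w″} →
                 F ⊢ w ⇒ zero ∣ w′ → loop F ⊢ w′ ⇒ l ∣ w″ → loop F ⊢ w ⇒ l ∣ w″
    again-spec p q .run μ e with p .run μ e
    ... | ν , r , f with q .run ν f
    ... | ξ , s , g = ξ , runs-again r s , g

    break-spec : ∀ {n} {F : Frag (suc n)} {w k w′} →
                 F ⊢ w ⇒ suc k ∣ w′ → loop F ⊢ w ⇒ k ∣ w′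
    break-spec p .run μ e with p .run μ e
    ... | ν , r , f = ν , runs-break r , f

-- A total language of list functions and its compilation

data Tree : Set where
  leaf : Tree
  node : Tree → Tree → Tree

-- Preorder with the root on top. It is self-delimiting, so the top tree can be handled without a
-- separator between it and the rest of the stack.
ser : Tree → List Sym → List Sym
ser leaf       r = leafSym ∷ r
ser (node t u) r = nodeSym ∷ ser t (ser u r)

data Ty : Set where
  bool : Ty
  _⊗_  : Ty → Ty → Ty
  list : Ty → Ty

infixr 4 _⊗_

⟦_⟧ : Ty → Set
⟦ bool ⟧   = Bool
⟦ A ⊗ B ⟧  = ⟦ A ⟧ × ⟦ B ⟧
⟦ list A ⟧ = List ⟦ A ⟧

-- A nonempty list has the shape of a pair, so `cons` compiles like pairing; and the root symbol
-- alone decides every case distinction.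
enc : ∀ A → ⟦ A ⟧ → Tree
enc bool     false    = leaf
enc bool     true     = node leaf leaf
enc (A ⊗ B)  (a , b)  = node (enc A a) (enc B b)
enc (list A) []       = leaf
enc (list A) (a ∷ as) = node (enc A a) (enc (list A) as)

-- Terms are point-free: an environment is a nest of pairs.
infix  2 _⟿_
infixr 9 _⊙_

data _⟿_ : Ty → Ty → Set where
  idn   : ∀ {A} → A ⟿ A
  _⊙_   : ∀ {A B C} → B ⟿ C → A ⟿ B → A ⟿ C
  ⟨_,_⟩ : ∀ {A B C} → A ⟿ B → A ⟿ C → A ⟿ B ⊗ C
  fst   : ∀ {A B} → A ⊗ B ⟿ A
  snd   : ∀ {A B} → A ⊗ B ⟿ B
  lit   : ∀ {A B} → ⟦ B ⟧ → A ⟿ B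
  cons  : ∀ {A X} → A ⟿ X → A ⟿ list X → A ⟿ list X
  cond  : ∀ {A B} → A ⟿ bool → A ⟿ B → A ⟿ B → A ⟿ B
  caseL : ∀ {A B X} → A ⟿ list X → A ⟿ B → (X ⊗ list X) ⊗ A ⟿ B → A ⟿ B
  fold  : ∀ {A B X} → A ⟿ list X → A ⟿ B → X ⊗ B ⊗ A ⟿ B → A ⟿ B

caseList : {B X : Set} → List X → B → (X → List X → B) → B
caseList []       n c = n
caseList (x ∷ xs) n c = c x xs

eval : ∀ {A B} → A ⟿ B → ⟦ A ⟧ → ⟦ B ⟧
eval idn           a = a
eval (g ⊙ f)       a = eval g (eval f a)
eval ⟨ f , g ⟩     a = eval f a , eval g a
eval fst           a = proj₁ a
eval snd           a = proj₂ a
eval (lit b)       a = b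
eval (cons f g)    a = eval f a ∷ eval g a
eval (cond b f g)  a = if eval b a then eval f a else eval g a
eval (caseL l n c)  a =
  caseList (eval l a) (eval n a) (λ x xs → eval c ((x , xs) , a))
eval (fold l i b)  a = foldl (λ s x → eval b (x , s , a)) (eval i a) (eval l a)

-- Compilation of terms into fragments

module Compiler (Γ : Set) where

  open Fragments Γ

  done′ : Frag 1
  done′ = skip zero

  feed : Bool → Fin 4 → Sym → Frag 1
  feed true  i s = push i s
  feed false i s = done′

  module Transfer (toB toC : Bool) where

    emit : Sym → Frag 1
    emit s = feed toB 1F s >> feed toC 2F s

    symbol : Sym → Frag 2
    symbol nodeSym = emit nodeSym >> (push 3F leafSym >> (push 3F leafSym >> skip 0F))
    symbol blank   = skip 0F
    symbol leafSym = emit leafSym >> skip 0F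

    pending : Sym → Frag 2
    pending blank   = skip 1F
    pending (suc _) = pop 0F >>= symbol

    body : Frag 2
    body = pop 3F >>= pending

    -- Tape 3 counts in unary the subtrees still to be read.
    transfer : Frag 1
    transfer = push 3F leafSym >> loop body

  open Transfer using (transfer)

  pourSymbol : Sym → Frag 2
  pourSymbol blank   = skip 1F
  pourSymbol (suc s) = push 0F (suc s) >> skip 0F

  source : Bool → Fin 4
  source false = 1F
  source true  = 2F

  pour : Bool → Frag 1
  pour i = loop (pop (source i) >>= pourSymbol)

  -- A transfer reverses a tree onto another tape and `pour` reverses it back. For the swap both
  -- trees are parked, on tapes 1 and 2, and the formerly upper one returns first.
  dropF dupF swapF : Frag 1
  dropF = transfer false false
  dupF  = transfer true true >> (pour false >> pour true)
  swapF = transfer true false >> (transfer false true >> (pour false >> pour true))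

  popF : Frag 1
  popF = pop 0F >>= λ _ → done′

  pairF : Frag 1 → Frag 1 → Frag 1
  pairF F G = dupF >> (F >> (swapF >> (G >> (swapF >> push 0F nodeSym))))

  fstF sndF : Frag 1
  fstF = popF >> (swapF >> dropF)
  sndF = popF >> dropF

  pushTree : Tree → Frag 1
  pushTree leaf       = push 0F leafSym
  pushTree (node t u) = pushTree u >> (pushTree t >> push 0F nodeSym)

  condF : Frag 1 → Frag 1 → Frag 1 → Frag 1
  condF B F G = dupF >> (B >> (pop 0F >>= branch))
    where
    branch : Sym → Frag 1
    branch blank   = done′
    branch leafSym = G
    branch nodeSym = popF >> (popF >> F)

  -- With the root of a nonempty list popped, the stack reads head, tail, saved input; the two
  -- pushed nodes regroup them as ((head , tail) , input).
  caseF : Frag 1 → Frag 1 → Frag 1 → Frag 1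
  caseF L F G = dupF >> (L >> (pop 0F >>= branch))
    where
    branch : Sym → Frag 1
    branch blank   = done′
    branch leafSym = F
    branch nodeSym = push 0F nodeSym >> (push 0F nodeSym >> G)

  foldStep : Frag 1 → Frag 1
  foldStep B = pairF (fstF >> sndF) (pairF (pairF (fstF >> fstF) sndF >> B) (sndF >> sndF))

  -- For a nonempty list the two roots popped by `foldBody` are pushed back, so that the step sees
  -- (x , xs) paired with (s , a). For an empty list they stay off, and (s , a) is what remains on
  -- the stack.
  foldBranch : Frag 1 → Sym → Frag 2
  foldBranch B blank   = skip 0F
  foldBranch B leafSym = skip 1F
  foldBranch B nodeSym = push 0F nodeSym >> (push 0F nodeSym >> (foldStep B >> skip 0F))

  foldBody : Frag 1 → Frag 2
  foldBody B = popF >> (pop 0F >>= foldBranch B)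

  compile : ∀ {A B} → A ⟿ B → Frag 1
  compile idn              = done′
  compile (g ⊙ f)          = compile f >> compile g
  compile ⟨ f , g ⟩        = pairF (compile f) (compile g)
  compile fst              = fstF
  compile snd              = sndF
  compile (lit {B = B} b)  = dropF >> pushTree (enc B b)
  compile (cons f g)       = pairF (compile f) (compile g)
  compile (cond b f g)     = condF (compile b) (compile f) (compile g)
  compile (caseL l n c)    = caseF (compile l) (compile n) (compile c)
  compile (fold l i b)     =
    pairF (compile l) (pairF (compile i) done′) >> (loop (foldBody (compile b)) >> fstF)

  module Correct (x : BitString) where

    open Exec x

    put : Bool → Sym → List Sym → List Sym
    put true  s b = s ∷ b
    put false s b = b

    pushed : (Sym → List Sym → List Sym) → Tree → List Sym → List Sym
    pushed f leaf       b = f leafSym b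
    pushed f (node t u) b = pushed f u (pushed f t (f nodeSym b))

    module _ (toB toC : Bool) where

      open Transfer toB toC using (body; emit)

      feed-B : ∀ f {s i o a b c d} →
               feed f 1F s ⊢ stacks i o a b c d ⇒ zero ∣ stacks i o a (put f s b) c d
      feed-B true  = push-spec 1F
      feed-B false = skip-spec

      feed-C : ∀ f {s i o a b c d} →
               feed f 2F s ⊢ stacks i o a b c d ⇒ zero ∣ stacks i o a b (put f s c) d
      feed-C true  = push-spec 2F
      feed-C false = skip-spec

      emit-spec : ∀ s {i o a b c d} →
                  emit s ⊢ stacks i o a b c d ⇒ zero ∣ stacks i o a (put toB s b) (put toC s c) d
      emit-spec s = feed-B toB » feed-C toC

      -- Stated with a continuation: the loop does not exit after a subtree, so the runs for the two
      -- subtrees of a node are chained through the rest of the loop.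
      transfer-tree : ∀ t {i o a b c d k w} →
        loop body ⊢ stacks i o a (pushed (put toB) t b) (pushed (put toC) t c) d ⇒ k ∣ w →
        loop body ⊢ stacks i o (ser t a) b c (leafSym ∷ d) ⇒ k ∣ w
      transfer-tree leaf p =
        again-spec (pop-spec 3F » pop-spec 0F » emit-spec leafSym » skip-spec) p
      transfer-tree (node t u) p =
        again-spec (pop-spec 3F » pop-spec 0F » emit-spec nodeSym »
                    push-spec 3F » push-spec 3F » skip-spec)
          (transfer-tree t (transfer-tree u p))

      transfer-spec : ∀ t {i o a b c} →
        transfer toB toC ⊢ stacks i o (ser t a) b c [] ⇒ zero
          ∣ stacks i o a (pushed (put toB) t b) (pushed (put toC) t c) []
      transfer-spec t = push-spec 3F » transfer-tree t (break-spec (pop-spec 3F » skip-spec))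

    arranged : Bool → ℕ → List Γ → List Sym → List Sym → List Sym → Stacks
    arranged false i o a b c = stacks i o a b c []
    arranged true  i o a b c = stacks i o a c b []

    pushed-none : ∀ t {b} → pushed (put false) t b ≡ b
    pushed-none leaf = refl
    pushed-none (node t u) {b} rewrite pushed-none t {b} = pushed-none u

    pour-symbol : ∀ j {s i o a b c k w} →
      pour j ⊢ arranged j i o (suc s ∷ a) b c ⇒ k ∣ w →
      pour j ⊢ arranged j i o a (suc s ∷ b) c ⇒ k ∣ w
    pour-symbol false = again-spec (pop-spec 1F » push-spec 0F » skip-spec)
    pour-symbol true  = again-spec (pop-spec 2F » push-spec 0F » skip-spec)

    pour-end : ∀ j {i o a c} → pour j ⊢ arranged j i o a [] c ⇒ zero ∣ arranged j i o a [] c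
    pour-end false = break-spec (pop-spec 1F » skip-spec)
    pour-end true  = break-spec (pop-spec 2F » skip-spec)

    pour-tree : ∀ j t {i o a b c k w} →
      pour j ⊢ arranged j i o (ser t a) b c ⇒ k ∣ w →
      pour j ⊢ arranged j i o a (pushed (put true) t b) c ⇒ k ∣ w
    pour-tree j leaf p       = pour-symbol j p
    pour-tree j (node t u) p = pour-tree j u (pour-tree j t (pour-symbol j p))

    pour-spec : ∀ j t {i o a c} →
      pour j ⊢ arranged j i o a (pushed (put true) t []) c ⇒ zero ∣ arranged j i o (ser t a) [] c
    pour-spec j t = pour-tree j t (pour-end j)

    main : ℕ → List Γ → List Sym → Stacks
    main i o a = stacks i o a [] [] []

    drop-spec : ∀ t {i o a} → dropF ⊢ main i o (ser t a) ⇒ zero ∣ main i o a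
    drop-spec t {i} {o} {a} with transfer-spec false false t {i} {o} {a} {[]} {[]}
    ... | p rewrite pushed-none t {[]} = p

    dup-spec : ∀ t {i o a} → dupF ⊢ main i o (ser t a) ⇒ zero ∣ main i o (ser t (ser t a))
    dup-spec t = transfer-spec true true t » pour-spec false t » pour-spec true t

    swap-spec : ∀ t u {i o a} →
                swapF ⊢ main i o (ser t (ser u a)) ⇒ zero ∣ main i o (ser u (ser t a))
    swap-spec t u {i} {o} {a}
      with transfer-spec true false t {i} {o} {ser u a} {[]} {[]}
         | transfer-spec false true u {i} {o} {a} {pushed (put true) t []} {[]}
    ... | p | q rewrite pushed-none t {[]} | pushed-none u {pushed (put true) t []} =
      p » q » pour-spec false t » pour-spec true u

    infix 0 _⊢_↦_
    -- The rest a of the stack is an arbitrary frame; this allows `pairF` to run one component while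
    -- other values are saved underneath.
    record _⊢_↦_ (F : Frag 1) (t u : Tree) : Set where
      field
        maps : ∀ {i o a} → F ⊢ main i o (ser t a) ⇒ zero ∣ main i o (ser u a)

    open _⊢_↦_ public

    popF-spec : ∀ {i o s a} → popF ⊢ main i o (s ∷ a) ⇒ zero ∣ main i o a
    popF-spec = pop-spec 0F » skip-spec

    done-maps : ∀ {t} → done′ ⊢ t ↦ t
    done-maps .maps = skip-spec

    infixr 1 _⨾_
    _⨾_ : ∀ {F G t u v} → F ⊢ t ↦ u → G ⊢ u ↦ v → F >> G ⊢ t ↦ v
    (p ⨾ q) .maps = p .maps » q .maps

    pair-maps : ∀ {F G t u v} → F ⊢ t ↦ u → G ⊢ t ↦ v → pairF F G ⊢ t ↦ node u v
    pair-maps {t = t} {u} {v} p q .maps =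
      dup-spec t » p .maps » swap-spec u t » q .maps » swap-spec v u » push-spec 0F

    fst-maps : ∀ {t u} → fstF ⊢ node t u ↦ t
    fst-maps {t} {u} .maps = popF-spec » swap-spec t u » drop-spec u

    snd-maps : ∀ {t u} → sndF ⊢ node t u ↦ u
    snd-maps {t} .maps = popF-spec » drop-spec t

    pushTree-spec : ∀ t {i o a} → pushTree t ⊢ main i o a ⇒ zero ∣ main i o (ser t a)
    pushTree-spec leaf       = push-spec 0F
    pushTree-spec (node t u) = pushTree-spec u » pushTree-spec t » push-spec 0F

    foldStep-maps : ∀ {B t u v e v′} → B ⊢ node t (node v e) ↦ v′ →
                    foldStep B ⊢ node (node t u) (node v e) ↦ node u (node v′ e)
    foldStep-maps p =
      pair-maps (fst-maps ⨾ snd-maps)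
        (pair-maps (pair-maps (fst-maps ⨾ fst-maps) snd-maps ⨾ p) (snd-maps ⨾ snd-maps))

    fold-loop : ∀ {F X B A} (f : ⟦ X ⟧ → ⟦ B ⟧ → ⟦ A ⟧ → ⟦ B ⟧) →
      (∀ x s a → F ⊢ enc (X ⊗ B ⊗ A) (x , s , a) ↦ enc B (f x s a)) → ∀ xs s a →
      loop (foldBody F) ⊢ enc (list X ⊗ B ⊗ A) (xs , s , a)
        ↦ enc (B ⊗ A) (foldl (λ s x → f x s a) s xs , a)
    fold-loop f p [] s a .maps = break-spec (popF-spec » pop-spec 0F » skip-spec)
    fold-loop f p (x ∷ xs) s a .maps =
      again-spec (popF-spec » pop-spec 0F » push-spec 0F » push-spec 0F »
                  foldStep-maps (p x s a) .maps » skip-spec)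
        (fold-loop f p xs (f x s a) a .maps)

    cond-maps : ∀ B b {C F G t u v} → C ⊢ t ↦ enc bool b → F ⊢ t ↦ enc B u → G ⊢ t ↦ enc B v →
                condF C F G ⊢ t ↦ enc B (if b then u else v)
    cond-maps B false {t = t} p q r .maps = dup-spec t » p .maps » pop-spec 0F » r .maps
    cond-maps B true  {t = t} p q r .maps =
      dup-spec t » p .maps » pop-spec 0F » popF-spec » popF-spec » q .maps

    case-maps : ∀ A X B xs {L F G a n c} → L ⊢ enc A a ↦ enc (list X) xs →
                F ⊢ enc A a ↦ enc B n →
                (∀ x xs → G ⊢ enc ((X ⊗ list X) ⊗ A) ((x , xs) , a) ↦ enc B (c x xs)) →
                caseF L F G ⊢ enc A a ↦ enc B (caseList xs n c)
    case-maps A X B [] {a = a} p q r .maps =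
      dup-spec (enc A a) » p .maps » pop-spec 0F » q .maps
    case-maps A X B (x ∷ xs) {a = a} p q r .maps =
      dup-spec (enc A a) » p .maps » pop-spec 0F » push-spec 0F » push-spec 0F »
      r x xs .maps

    compile-correct : ∀ {A B} (f : A ⟿ B) a → compile f ⊢ enc A a ↦ enc B (eval f a)
    compile-correct idn a       = done-maps
    compile-correct (g ⊙ f) a   = compile-correct f a ⨾ compile-correct g (eval f a)
    compile-correct ⟨ f , g ⟩ a = pair-maps (compile-correct f a) (compile-correct g a)
    compile-correct fst a       = fst-maps
    compile-correct snd a       = snd-maps
    compile-correct {A} (lit {B = B} b) a .maps =
      drop-spec (enc A a) » pushTree-spec (enc B b)
    compile-correct (cons f g) a = pair-maps (compile-correct f a) (compile-correct g a)
    compile-correct {B = B} (cond b f g) a =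
      cond-maps B (eval b a) (compile-correct b a) (compile-correct f a) (compile-correct g a)
    compile-correct {A} {B} (caseL {X = X} l n c) a =
      case-maps A X B (eval l a) (compile-correct l a) (compile-correct n a)
        (λ x xs → compile-correct c ((x , xs) , a))
    compile-correct {A} {B} (fold {X = X} l i b) a =
      pair-maps (compile-correct l a) (pair-maps (compile-correct i a) done-maps) ⨾
      fold-loop {X = X} {B} {A} (λ x s e → eval b (x , s , e))
        (λ x s e → compile-correct b (x , s , e)) (eval l a) (eval i a) a ⨾
      fst-maps

-- Machines with a hardwired string

cellBits : Maybe Bool → List Bool
cellBits nothing  = []
cellBits (just b) = b ∷ []

-- One round of a program sees the scanned input cell and its own state, and
-- returns the flags "halt" and "advance", two bits naming the output, and the
-- next state.
record Program (Γ : Set) : Set where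
  field
    S      : Ty
    output : Bool → Bool → Maybe Γ
    init   : list bool ⟿ S
    round  : list bool ⊗ S ⟿ bool ⊗ bool ⊗ bool ⊗ bool ⊗ S

-- The preorder symbols of the bit from last to first, followed by the node of the list cell that
-- holds it.
loadedBit : Bool → List Bool
loadedBit false = false ∷ true ∷ []
loadedBit true  = false ∷ false ∷ true ∷ true ∷ []

-- The serialisation of q from its last symbol to its first, true for nodeSym.
loaded : List Bool → List Bool
loaded []      = false ∷ []
loaded (b ∷ q) = loaded q ++ loadedBit b

bitSym : Bool → Sym
bitSym false = leafSym
bitSym true  = nodeSym

pushAll : List Bool → List Sym → List Sym
pushAll ws a = foldl (λ a w → bitSym w ∷ a) a ws

pushAll-loaded : ∀ q a → pushAll (loaded q) a ≡ ser (enc (list bool) q) a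
pushAll-loaded [] a = refl
pushAll-loaded (b ∷ q) a
  rewrite foldl-++ (λ a w → bitSym w ∷ a) a (loaded q) (loadedBit b) | pushAll-loaded q a
  with b
... | false = refl
... | true  = refl

relabel : ∀ {m n} → (Fin m → Fin n) → Maybe (Bool × Fin m) → Maybe (Bool × Fin n)
relabel f nothing        = nothing
relabel f (just (v , k)) = just (v , f k)

relabel-id : ∀ {n} (m : Maybe (Bool × Fin n)) → relabel id m ≡ m
relabel-id nothing  = refl
relabel-id (just _) = refl

relabel-∘ : ∀ {l m n} (f : Fin m → Fin n) (g : Fin l → Fin m) x →
            relabel f (relabel g x) ≡ relabel (f ∘ g) x
relabel-∘ f g nothing  = refl
relabel-∘ f g (just _) = refl

-- The chain of states that hardwires ws: one state for each symbol to be pushed, and a last one,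
-- answered by `nothing`, that enters the driver.
loaderStep : (ws : List Bool) → Fin (suc (length ws)) → Maybe (Bool × Fin (suc (length ws)))
loaderStep []       _       = nothing
loaderStep (w ∷ ws) zero    = just (w , suc zero)
loaderStep (w ∷ ws) (suc j) = relabel suc (loaderStep ws j)

module Boot {Γ : Set} (driver : Fragments.Frag Γ 1) where

  open Fragments Γ
  open Frag
  open Finite

  size : ℕ
  size = count (finite driver)

  module _ (ws : List Bool) where

    #loader : ℕ
    #loader = suc (length ws)

    -- State zero is initial by convention, so it is reserved for a jump to the loader; halting also
    -- needs a state of its own, in which the table has no action.
    #states : ℕ
    #states = 2 + (size + #loader)

    haltIx : Fin #states
    haltIx = 1F

    driverIx : State driver → Fin #states
    driverIx s = suc (suc (index (finite driver) s ↑ˡ #loader))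

    loaderIx : Fin #loader → Fin #states
    loaderIx j = suc (suc (size ↑ʳ j))

    command : Act → Fin #states → Action Γ #states 3 4
    command (act a o w) n = action n a o w

    driverTarget : State driver ⊎ Fin 1 → Fin #states
    driverTarget (inj₁ s) = driverIx s
    driverTarget (inj₂ _) = haltIx

    driverRow : Act × (State driver ⊎ Fin 1) → Action Γ #states 3 4
    driverRow (a , t) = command a (driverTarget t)

    loaderRow : Maybe (Bool × Fin #loader) → Action Γ #states 3 4
    loaderRow nothing        = command waiting (driverIx (entry driver))
    loaderRow (just (w , j)) = command (pushing 0F (bitSym w)) (loaderIx j)

    middle : Fin size ⊎ Fin #loader → Maybe Bool → Vec Sym 4 → Action Γ #states 3 4
    middle (inj₁ i) b ss = driverRow (δ driver (from (finite driver) i) b ss)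
    middle (inj₂ j) b ss = loaderRow (loaderStep ws j)

    machine : Machine Γ
    machine .Machine.states-1  = suc (size + #loader)
    machine .Machine.symbols-1 = 2
    machine .Machine.tapes-1   = 3
    machine .Machine.δ zero          b ss = just (command waiting (loaderIx zero))
    machine .Machine.δ (suc zero)    b ss = nothing
    machine .Machine.δ (suc (suc k)) b ss = just (middle (splitAt size k) b ss)

    open Run machine using (Config; config; initial; Step; Halted; Reachable)

    configure : Fin #states → World → Config
    configure n (world i o ts) = config n i o ts

    module _ (x : BitString) where

      open Exec x

      perform-command : ∀ a n m μ →
                        Run.perform machine (command a n) (configure m μ) ≡ configure n (effect a μ)
      perform-command (act a o w) n m (world i out ts)
        = config-cong (advance≡ a) (output≡ o) (work≡ w ts)
        where
        config-cong : ∀ {i i′ o o′ t t′} → i ≡ i′ → o ≡ o′ → t ≡ t′ →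
                      config n i o t ≡ config n i′ o′ t′
        config-cong refl refl refl = refl
        advance≡ : ∀ a → Run.advanced machine a i ≡ advancedTo a i
        advance≡ true  = refl
        advance≡ false = refl
        output≡ : ∀ o → Run.appended machine o out ≡ appendedTo o out
        output≡ nothing  = refl
        output≡ (just _) = refl
        work≡ : ∀ {n} (w : Vec (Sym × Move) n) ts →
                Vec.zipWith (Run.operate machine) w ts ≡ Vec.zipWith operateOn w ts
        work≡ []      []       = refl
        work≡ (v ∷ w) (t ∷ ts) = cong (_ ∷_) (work≡ w ts)

      command-step : ∀ a n m μ →
        Run.decision machine x (configure m μ) ≡ just (command a n) →
        Step x (configure m μ) (configure n (effect a μ))
      command-step a n m μ e = command a n , e , sym (perform-command a n m μ)

      heads : World → Vec Sym 4
      heads μ = Vec.map Tape.scanned (World.memory μ)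

      driver-step : ∀ {s} μ {a t} → at driver s μ ≡ (a , t) →
                    Step x (configure (driverIx s) μ) (configure (driverTarget t) (effect a μ))
      driver-step {s} μ {a} {t} e = command-step a (driverTarget t) (driverIx s) μ
        (trans (cong (λ k → just (middle k (inputCell x (World.position μ)) (heads μ)))
                     (splitAt-↑ˡ size (index (finite driver) s) #loader))
          (trans (cong (λ s → just (driverRow (at driver s μ))) (from-index (finite driver) s))
            (cong (just ∘ driverRow) e)))

      loader-step : ∀ j μ →
        Run.decision machine x (configure (loaderIx j) μ) ≡ just (loaderRow (loaderStep ws j))
      loader-step j μ =
        cong (λ k → just (middle k (inputCell x (World.position μ)) (heads μ))) (splitAt-↑ʳ size #loader j)

      _⟶⁺_ : Config → Config → Set
      c ⟶⁺ d = ∃[ e ] Step x c e × Star (Step x) e d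

      plus→star : ∀ {c d} → c ⟶⁺ d → Star (Step x) c d
      plus→star (e , s , r) = s ◅ r

      driver-path : ∀ {s μ t ν} → Path driver s μ t ν →
                    configure (driverIx s) μ ⟶⁺ configure (driverIx t) ν
      driver-path (last e)   = _ , driver-step _ e , ε
      driver-path (more e p) = _ , driver-step _ e , plus→star (driver-path p)

      driver-runs : ∀ {s μ ν} → Runs driver s μ zero ν →
                    Star (Step x) (configure (driverIx s) μ) (configure haltIx ν)
      driver-runs (done e)   = driver-step _ e ◅ ε
      driver-runs (more e r) = driver-step _ e ◅ driver-runs r

      -- Induction over the suffixes vs of ws. The map f locates the chain of vs inside the chain of
      -- ws, and the hypothesis says that it respects successors; for the whole of ws it is the
      -- identity.
      loader-path : (vs : List Bool) (f : Fin (suc (length vs)) → Fin #loader) →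
        (∀ j → loaderStep ws (f j) ≡ relabel f (loaderStep vs j)) →
        ∀ μ {i o a} → view μ ≡ stacks i o a [] [] [] →
        ∃[ ν ] Star (Step x) (configure (loaderIx (f zero)) μ)
                             (configure (driverIx (entry driver)) ν)
             × view ν ≡ stacks i o (pushAll vs a) [] [] []
      loader-path [] f p μ v =
        effect waiting μ ,
        command-step waiting (driverIx (entry driver)) (loaderIx (f zero)) μ
          (trans (loader-step (f zero) μ) (cong (just ∘ loaderRow) (p zero))) ◅ ε ,
        trans (waiting-view μ) v
      loader-path (w ∷ vs) f p μ v =
        proj₁ ih ,
        command-step (pushing 0F (bitSym w)) (loaderIx (f (suc zero))) (loaderIx (f zero)) μ
          (trans (loader-step (f zero) μ) (cong (just ∘ loaderRow) (p zero)))
          ◅ proj₁ (proj₂ ih) ,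
        proj₂ (proj₂ ih)
        where
        ih = loader-path vs (f ∘ suc)
          (λ j → trans (p (suc j)) (relabel-∘ f suc (loaderStep vs j)))
          (effect (pushing 0F (bitSym w)) μ)
          (trans (push-view 0F μ) (cong (update 0F (bitSym w ∷_)) v))

      booted : ∃[ ν ] Reachable x (configure (driverIx (entry driver)) ν)
                    × view ν ≡ stacks 0 [] (pushAll ws []) [] [] []
      booted = proj₁ path , start ◅ proj₁ (proj₂ path) , proj₂ (proj₂ path)
        where
        μ₀ : World
        μ₀ = world 0 [] (Vec.replicate 4 (tape [] zero []))

        start : Step x initial (configure (loaderIx zero) (effect waiting μ₀))
        start = command-step waiting (loaderIx zero) zero μ₀ refl

        path = loader-path ws id (λ j → sym (relabel-id (loaderStep ws j)))
                 (effect waiting μ₀) refl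

module Hardwired {Γ : Set} (prog : Program Γ) where

  open Program prog
  open Fragments Γ
  open Compiler Γ
  open Frag

  exit : Bool → Fin 2
  exit false = 0F
  exit true  = 1F

  isTrue : Fin 2 → Bool
  isTrue 0F = false
  isTrue 1F = true

  isTrue-exit : ∀ b → isTrue (exit b) ≡ b
  isTrue-exit false = refl
  isTrue-exit true  = refl

  popBool : Frag 2
  popBool = pop 0F >>= branch
    where
    branch : Sym → Frag 2
    branch blank   = skip 0F
    branch leafSym = skip 0F
    branch nodeSym = popF >> (popF >> skip 1F)

  obey : Fin 2 → Frag 2
  obey 1F = skip 1F
  obey 0F =
    (popF >> popBool) >>= λ a → (popF >> popBool) >>= λ e → (popF >> popBool) >>= λ f →
    (perform (isTrue a) (output (isTrue e) (isTrue f)) >> skip 0F)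

  cellOf : Fin 3 → List Bool
  cellOf 0F = []
  cellOf 1F = false ∷ []
  cellOf 2F = true ∷ []

  cellOf-exit : ∀ b → cellOf (cellExit b) ≡ cellBits b
  cellOf-exit nothing      = refl
  cellOf-exit (just false) = refl
  cellOf-exit (just true)  = refl

  body : Frag 2
  body = look >>= λ c → pushTree (enc (list bool) (cellOf c)) >>
    (push 0F nodeSym >> (compile round >> ((popF >> popBool) >>= obey)))

  driver : Frag 1
  driver = compile init >> loop body

  open Boot driver public

  module _ (ws : List Bool) where

    open Run (machine ws) using (Config; Step; Halted; Reachable)

    module _ (x : BitString) where

      open Exec x
      open Correct x

      headState : State driver
      headState = inj₂ (zero , entry body)

      -- The configurations in which a round begins. The indices are all that later arguments need
      -- to know of them; contents of the tapes beyond the serialised state stay hidden.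
      data AtHead (s : ⟦ S ⟧) (i : ℕ) (o : List Γ) : Config → Set where
        atHead : ∀ μ {a} → view μ ≡ main i o (ser (enc S s) a) →
                 AtHead s i o (configure ws (driverIx ws headState) μ)

      popBool-spec : ∀ b {i o a} →
                     popBool ⊢ main i o (ser (enc bool b) a) ⇒ exit b ∣ main i o a
      popBool-spec false = pop-spec 0F » skip-spec
      popBool-spec true  = pop-spec 0F » popF-spec » popF-spec » skip-spec

      round-maps : ∀ b {s r} → eval round (cellBits b , s) ≡ r →
        compile round ⊢ node (enc (list bool) (cellOf (cellExit b))) (enc S s)
          ↦ enc (bool ⊗ bool ⊗ bool ⊗ bool ⊗ S) r
      round-maps b {s} refl rewrite cellOf-exit b = compile-correct round (cellBits b , s)

      perform-flags : ∀ a e f {i o t} →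
        perform (isTrue (exit a)) (output (isTrue (exit e)) (isTrue (exit f)))
          ⊢ main i o t ⇒ zero ∣ main (advancedTo a i) (appendedTo (output e f) o) t
      perform-flags a e f rewrite isTrue-exit a | isTrue-exit e | isTrue-exit f = perform-spec

      obey-spec : ∀ a e f s {i o r} →
        obey 0F ⊢ main i o (ser (enc (bool ⊗ bool ⊗ bool ⊗ S) (a , e , f , s)) r) ⇒ 0F
          ∣ main (advancedTo a i) (appendedTo (output e f) o) (ser (enc S s) r)
      obey-spec a e f s =
        (popF-spec » popBool-spec a) » (popF-spec » popBool-spec e) »
        (popF-spec » popBool-spec f) » perform-flags a e f » skip-spec

      body-spec : ∀ {i o s a e f s′ r h k w} →
        eval round (cellBits (inputCell x i) , s) ≡ (h , a , e , f , s′) →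
        obey (exit h) ⊢ main i o (ser (enc (bool ⊗ bool ⊗ bool ⊗ S) (a , e , f , s′)) r) ⇒ k ∣ w →
        body ⊢ main i o (ser (enc S s) r) ⇒ k ∣ w
      body-spec {i} {h = h} eq p =
        look-spec » pushTree-spec (enc (list bool) (cellOf (cellExit (inputCell x i)))) »
        push-spec 0F » round-maps (inputCell x i) eq .maps » (popF-spec » popBool-spec h) » p

      starts : ∀ q → ws ≡ loaded q → ∃[ c ] Reachable x c × AtHead (eval init q) 0 [] c
      starts q refl = go (booted ws x)
        where
        go : ∃[ μ ] Reachable x (configure ws (driverIx ws (entry driver)) μ)
                  × view μ ≡ main 0 [] (pushAll ws []) → _
        go (μ , r , v) = go′ (compile-correct init q .maps .run μ
                                (trans v (cong (main 0 []) (pushAll-loaded q []))))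
          where
          go′ : ∃[ ν ] Runs (compile init) (entry (compile init)) μ zero ν
                     × view ν ≡ main 0 [] (ser (enc S (eval init q)) []) → _
          go′ (ν , t , u) = _ , r ◅◅ plus→star ws x (driver-path ws x (path-bind t)) , atHead ν u

      continue : ∀ {i o s a e f s′ c} → AtHead s i o c →
        eval round (cellBits (inputCell x i) , s) ≡ (false , a , e , f , s′) →
        ∃[ d ] (_⟶⁺_ ws x c d) × AtHead s′ (advancedTo a i) (appendedTo (output e f) o) d
      continue {i} {o} {s} {a} {e} {f} {s′} (atHead μ {r} v) eq =
        go (body-spec eq (obey-spec a e f s′) .run μ v)
        where
        go : ∃[ ν ] Runs body (entry body) μ 0F ν
                  × view ν ≡ main (advancedTo a i) (appendedTo (output e f) o) (ser (enc S s′) r) → _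
        go (ν , r , u) = _ , driver-path ws x (path-inner {k = zero} (path-again r)) , atHead ν u

      halt : ∀ {i o s r c} → AtHead s i o c →
        eval round (cellBits (inputCell x i) , s) ≡ (true , r) →
        ∃[ d ] Star (Step x) c d × Halted x d × Config.position d ≡ i × Config.written d ≡ o
      halt {i} {o} {r = a , e , f , s} (atHead μ {t} v) eq =
        go (body-spec eq skip-spec .run μ v)
        where
        go : ∃[ ν ] Runs body (entry body) μ 1F ν
                  × view ν ≡ main i o (ser (enc (bool ⊗ bool ⊗ bool ⊗ S) (a , e , f , s)) t) → _
        go (ν , r , u) = _ , driver-runs ws x (runs-inner {k = zero} (runs-break r)) , refl ,
                         view-position {ν} u , view-written {ν} u

      head-written : ∀ {i o s c} → AtHead s i o c → Config.written c ≡ o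
      head-written (atHead μ v) = view-written {μ} v

-- The code of a hardwired machine is computable from the string

foldl-++-concatMap : ∀ {A B : Set} (f : A → List B) s xs →
                     foldl (λ s x → s ++ f x) s xs ≡ s ++ concatMap f xs
foldl-++-concatMap f s []       = sym (++-identityʳ s)
foldl-++-concatMap f s (x ∷ xs) =
  trans (foldl-++-concatMap f (s ++ f x) xs) (++-assoc s (f x) (concatMap f xs))

-- Later functions are written directly in Agda, and a term is built alongside with the same
-- structure; reasoning about them then takes place on the Agda side.
record Computable (A B : Ty) (f : ⟦ A ⟧ → ⟦ B ⟧) : Set where
  constructor computable
  field
    term    : A ⟿ B
    correct : ∀ a → eval term a ≡ f a

open Computable public

module _ {A : Ty} where

  idC : Computable A A (λ a → a)
  idC = computable idn (λ _ → refl)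

  litC : ∀ {B} b → Computable A B (λ _ → b)
  litC b = computable (lit b) (λ _ → refl)

  infixr 9 _∘C_
  _∘C_ : ∀ {B C} {g : ⟦ B ⟧ → ⟦ C ⟧} {f : ⟦ A ⟧ → ⟦ B ⟧} →
         Computable B C g → Computable A B f → Computable A C (λ a → g (f a))
  (g ∘C f) .term = term g ⊙ term f
  _∘C_ {g = h} g f .correct a = trans (correct g _) (cong h (correct f a))

  infixr 4 _,C_
  _,C_ : ∀ {B C} {f : ⟦ A ⟧ → ⟦ B ⟧} {g : ⟦ A ⟧ → ⟦ C ⟧} →
         Computable A B f → Computable A C g → Computable A (B ⊗ C) (λ a → f a , g a)
  (f ,C g) .term = ⟨ term f , term g ⟩
  (f ,C g) .correct a = cong₂ _,_ (correct f a) (correct g a)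

  fstC : ∀ {B C} {f : ⟦ A ⟧ → ⟦ B ⊗ C ⟧} → Computable A (B ⊗ C) f →
         Computable A B (λ a → proj₁ (f a))
  fstC f .term = fst ⊙ term f
  fstC f .correct a = cong proj₁ (correct f a)

  sndC : ∀ {B C} {f : ⟦ A ⟧ → ⟦ B ⊗ C ⟧} → Computable A (B ⊗ C) f →
         Computable A C (λ a → proj₂ (f a))
  sndC f .term = snd ⊙ term f
  sndC f .correct a = cong proj₂ (correct f a)

  infixr 5 _∷C_
  _∷C_ : ∀ {X} {f : ⟦ A ⟧ → ⟦ X ⟧} {g : ⟦ A ⟧ → List ⟦ X ⟧} →
         Computable A X f → Computable A (list X) g → Computable A (list X) (λ a → f a ∷ g a)
  (f ∷C g) .term = cons (term f) (term g)
  (f ∷C g) .correct a = cong₂ _∷_ (correct f a) (correct g a)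

  ifC : ∀ {B} {b : ⟦ A ⟧ → Bool} {f g : ⟦ A ⟧ → ⟦ B ⟧} →
        Computable A bool b → Computable A B f → Computable A B g →
        Computable A B (λ a → if b a then f a else g a)
  ifC b f g .term = cond (term b) (term f) (term g)
  ifC {b = c} b f g .correct a rewrite correct b a with c a
  ... | true  = correct f a
  ... | false = correct g a

  caseC : ∀ {B X} {l : ⟦ A ⟧ → List ⟦ X ⟧} {n : ⟦ A ⟧ → ⟦ B ⟧}
            {c : ⟦ (X ⊗ list X) ⊗ A ⟧ → ⟦ B ⟧} →
          Computable A (list X) l → Computable A B n → Computable ((X ⊗ list X) ⊗ A) B c →
          Computable A B (λ a → caseList (l a) (n a) (λ x xs → c ((x , xs) , a)))
  caseC l n c .term = caseL (term l) (term n) (term c)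
  caseC {l = f} l n c .correct a rewrite correct l a with f a
  ... | []     = correct n a
  ... | x ∷ xs = correct c ((x , xs) , a)

  foldC : ∀ {B X} {l : ⟦ A ⟧ → List ⟦ X ⟧} {i : ⟦ A ⟧ → ⟦ B ⟧} {b : ⟦ X ⊗ B ⊗ A ⟧ → ⟦ B ⟧} →
          Computable A (list X) l → Computable A B i → Computable (X ⊗ B ⊗ A) B b →
          Computable A B (λ a → foldl (λ s x → b (x , s , a)) (i a) (l a))
  foldC l i b .term = fold (term l) (term i) (term b)
  foldC {l = k} {i = j} l i b .correct a rewrite correct l a | correct i a =
    foldl-cong (λ s x → correct b (x , s , a)) (j a) (k a)

  viaC : ∀ {B} {f g : ⟦ A ⟧ → ⟦ B ⟧} → Computable A B f → (∀ a → f a ≡ g a) → Computable A B g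
  viaC f e .term = term f
  viaC f e .correct a = trans (correct f a) (e a)

module _ {A X : Ty} {f : ⟦ A ⟧ → List ⟦ X ⟧} (F : Computable A (list X) f) where

  reverseC : Computable A (list X) (λ a → reverse (f a))
  reverseC = foldC F (litC []) (fstC idC ∷C fstC (sndC idC))

module _ {A X : Ty} {f g : ⟦ A ⟧ → List ⟦ X ⟧}
         (F : Computable A (list X) f) (G : Computable A (list X) g) where

  _ʳ++C_ : Computable A (list X) (λ a → f a ʳ++ g a)
  _ʳ++C_ = foldC F G (fstC idC ∷C fstC (sndC idC))

module _ {A X : Ty} {f g : ⟦ A ⟧ → List ⟦ X ⟧} where

  infixr 5 _++C_
  -- The language builds lists by prepending and folds from the left, whence the double reversal.
  _++C_ : Computable A (list X) f → Computable A (list X) g → Computable A (list X) (λ a → f a ++ g a)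
  F ++C G = viaC (reverseC F ʳ++C G) λ a →
    trans (ʳ++-defn (reverse (f a))) (cong (_++ g a) (reverse-involutive (f a)))

loadedC : Computable (list bool) (list bool) loaded
loadedC = viaC (litC false ∷C foldC {b = λ (b , s , _) → loadedBit b ++ s} idC (litC [])
                  (viaC (ifC (fstC idC) (litC (loadedBit true)) (litC (loadedBit false))) bit
                   ++C fstC (sndC idC)))
               (λ q → trans (fold-loaded q []) (++-identityʳ (loaded q)))
  where
  bit : ∀ {E : Set} (z : Bool × List Bool × E) →
        (if proj₁ z then loadedBit true else loadedBit false) ≡ loadedBit (proj₁ z)
  bit (false , _) = refl
  bit (true , _)  = refl

  fold-loaded : ∀ q s → false ∷ foldl (λ s b → loadedBit b ++ s) s q ≡ loaded q ++ s
  fold-loaded []      s = refl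
  fold-loaded (b ∷ q) s =
    trans (fold-loaded q (loadedBit b ++ s)) (sym (++-assoc (loaded q) (loadedBit b) s))

concatMap-cartesianProduct : ∀ {A B C : Set} (f : A × B → List C) xs ys →
  concatMap f (cartesianProduct xs ys) ≡ concatMap (λ x → concatMap (λ y → f (x , y)) ys) xs
concatMap-cartesianProduct f []       ys = refl
concatMap-cartesianProduct f (x ∷ xs) ys =
  trans (concatMap-++ f (map (x ,_) ys) (cartesianProduct xs ys))
    (cong₂ _++_ (concatMap-map f (x ,_) ys) (concatMap-cartesianProduct f xs ys))

gather : ∀ {A : Set} n → (Fin n → List A) → List A
gather zero    f = []
gather (suc n) f = f zero ++ gather n (f ∘ suc)

gather-cong : ∀ {A : Set} n {f g : Fin n → List A} → (∀ i → f i ≡ g i) → gather n f ≡ gather n g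
gather-cong zero    p = refl
gather-cong (suc n) p = cong₂ _++_ (p zero) (gather-cong n (p ∘ suc))

gather-+ : ∀ {A : Set} m n (f : Fin (m + n) → List A) →
           gather (m + n) f ≡ gather m (λ i → f (i ↑ˡ n)) ++ gather n (λ j → f (m ↑ʳ j))
gather-+ zero    n f = refl
gather-+ (suc m) n f =
  trans (cong (f zero ++_) (gather-+ m n (f ∘ suc))) (sym (++-assoc (f zero) _ _))

concatMap-tabulate : ∀ {A B : Set} n (f : A → List B) (g : Fin n → A) →
                     concatMap f (tabulate g) ≡ gather n (f ∘ g)
concatMap-tabulate zero    f g = refl
concatMap-tabulate (suc n) f g = cong (f (g zero) ++_) (concatMap-tabulate n f (g ∘ suc))

-- Opaque, so that the list is never unfolded for a concrete machine.
opaque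
  viewsAt : ∀ symbols tapes → List (Maybe Bool × Vec (Fin symbols) tapes)
  viewsAt symbols tapes =
    cartesianProduct (nothing ∷ just false ∷ just true ∷ []) (vectors (allFin symbols) tapes)

  machineCode-views : ∀ {Γ : Set} (code : Γ → BitString) (M : Machine Γ) → let open Machine M in
    Encoding.machineCode code M ≡ unary tapes ++ unary symbols ++ unary states ++
      concatMap (Encoding.rowCode code M) (cartesianProduct (allFin states) (viewsAt symbols tapes))
  machineCode-views code M = refl

-- The transition table of a hardwired machine as text

module Coding {Γ : Set} (code : Γ → BitString) (driver : Fragments.Frag Γ 1) where

  open Fragments Γ
  open Frag
  open Finite
  open Boot driver

  workText : Sym × Move → BitString
  workText (s , m) = unary (toℕ s) ++ moveCode m

  actText : Act → BitString
  actText (act a o w) = [ a ] ++ maybeCode code o ++ concatMap workText (Vec.toList w)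

  views : List (Maybe Bool × Vec Sym 4)
  views = viewsAt 3 4

  viewText : Maybe Bool × Vec Sym 4 → BitString
  viewText (b , ss) = maybeCode [_] b ++ concatMap (unary ∘ toℕ) (Vec.toList ss)

  -- The rows of a state that acts alike whatever it scans, as every state outside the driver does:
  -- u is the code of the state and v that of its action.
  block : BitString → BitString → BitString
  block u v = concatMap (λ t → u ++ t ++ v) (map viewText views)

  jumpText : ℕ → Act → BitString
  jumpText n a = true ∷ unary n ++ actText a

  loaderText : ℕ → List Bool → BitString
  loaderText n []       =
    block (unary n) (jumpText (2 + toℕ (index (finite driver) (entry driver))) waiting)
  loaderText n (w ∷ ws) =
    block (unary n) (jumpText (suc n) (pushing 0F (bitSym w))) ++ loaderText (suc n) ws

  targetNumber : State driver ⊎ Fin 1 → ℕ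
  targetNumber (inj₁ s) = 2 + toℕ (index (finite driver) s)
  targetNumber (inj₂ _) = 1

  driverRowText : Fin size → Maybe Bool × Vec Sym 4 → BitString
  driverRowText i (b , ss) = unary (2 + toℕ i) ++ viewText (b , ss) ++
    (let (a , t) = δ driver (from (finite driver) i) b ss in jumpText (targetNumber t) a)

  -- The rows common to all strings ws. Even the start state belongs here, as the first loader state
  -- has a fixed number; that number is left as a sum with 0 to agree with `loaderNumber` at `zero`.
  baseText : BitString
  baseText = block (unary 0) (jumpText (2 + (size + 0)) waiting)
    ++ block (unary 1) [ false ]
    ++ gather size (λ i → concatMap (driverRowText i) views)

  machineText : List Bool → BitString
  machineText ws = unary 4 ++ unary 3 ++ unary (2 + (size + suc (length ws)))
    ++ baseText ++ loaderText (2 + (size + 0)) ws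

  module _ (ws : List Bool) where

    open Encoding code (machine ws)

    rowText : ∀ q v t → maybeCode actionCode (Machine.δ (machine ws) q (proj₁ v) (proj₂ v)) ≡ t →
              rowCode (q , v) ≡ unary (toℕ q) ++ viewText v ++ t
    rowText q (b , ss) _ refl =
      cong (unary (toℕ q) ++_) (sym (++-assoc (maybeCode [_] b) _ _))

    stateText : Fin (#states ws) → BitString
    stateText q = concatMap (λ v → rowCode (q , v)) views

    block-text : ∀ q t → (∀ v → maybeCode actionCode (Machine.δ (machine ws) q (proj₁ v) (proj₂ v)) ≡ t) →
                 stateText q ≡ block (unary (toℕ q)) t
    block-text q t p =
      trans (concatMap-cong (λ v → rowText q v t (p v)) views)
            (sym (concatMap-map (λ u → unary (toℕ q) ++ u ++ t) viewText views))

    commandText : ∀ a n k → toℕ n ≡ k → true ∷ actionCode (command ws a n) ≡ jumpText k a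
    commandText (act a o w) n _ refl = refl

    driverTarget-number : ∀ t → toℕ (driverTarget ws t) ≡ targetNumber t
    driverTarget-number (inj₁ s) = cong (2 +_) (toℕ-↑ˡ _ (#loader ws))
    driverTarget-number (inj₂ _) = refl

    driver-text : ∀ i → stateText (suc (suc (i ↑ˡ #loader ws))) ≡ concatMap (driverRowText i) views
    driver-text i = concatMap-cong row views
      where
      row : ∀ v → rowCode (suc (suc (i ↑ˡ #loader ws)) , v) ≡ driverRowText i v
      row v@(b , ss) =
        trans (rowText (suc (suc (i ↑ˡ #loader ws))) v
                 (jumpText (targetNumber (proj₂ d)) (proj₁ d))
                 (trans (cong (λ k → true ∷ actionCode (middle ws k b ss))
                              (splitAt-↑ˡ size i (#loader ws)))
                   (commandText (proj₁ d) (driverTarget ws (proj₂ d)) _ (driverTarget-number (proj₂ d)))))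
              (cong (λ n → unary (2 + n) ++ viewText v ++ jumpText (targetNumber (proj₂ d)) (proj₁ d))
                    (toℕ-↑ˡ i (#loader ws)))
        where
        d = δ driver (from (finite driver) i) b ss

    loaderNumber : ∀ j → toℕ (loaderIx ws j) ≡ 2 + (size + toℕ j)
    loaderNumber j = cong (2 +_) (toℕ-↑ʳ size j)

    loader-block : ∀ j t → true ∷ actionCode (loaderRow ws (loaderStep ws j)) ≡ t →
                   stateText (loaderIx ws j) ≡ block (unary (2 + (size + toℕ j))) t
    loader-block j t p =
      trans (block-text (loaderIx ws j) t (λ (b , ss) →
               trans (cong (λ k → true ∷ actionCode (middle ws k b ss))
                           (splitAt-↑ʳ size (#loader ws) j)) p))
            (cong (λ n → block (unary n) t) (loaderNumber j))

    -- The same embedding of a suffix as in `loader-path`, with n the number of the state where its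
    -- chain begins.
    loader-text : ∀ n vs (f : Fin (suc (length vs)) → Fin (#loader ws)) →
      (∀ j → loaderStep ws (f j) ≡ relabel f (loaderStep vs j)) →
      (∀ j → 2 + (size + toℕ (f j)) ≡ n + toℕ j) →
      gather (suc (length vs)) (stateText ∘ loaderIx ws ∘ f) ≡ loaderText n vs
    loader-text n [] f p e = trans (++-identityʳ _)
      (trans (loader-block (f zero) bootText (trans
                (cong (λ m → true ∷ actionCode (loaderRow ws m)) (p zero))
                (commandText waiting (driverIx ws (entry driver)) _
                  (driverTarget-number (inj₁ (entry driver))))))
        (cong (λ n → block (unary n) bootText) (trans (e zero) (+-identityʳ n))))
      where
      bootText : BitString
      bootText = jumpText (2 + toℕ (index (finite driver) (entry driver))) waiting
    loader-text n (w ∷ vs) f p e = cong₂ _++_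
      (trans (loader-block (f zero) pushText (trans
                (cong (λ m → true ∷ actionCode (loaderRow ws m)) (p zero))
                (commandText (pushing 0F (bitSym w)) (loaderIx ws (f (suc zero))) (suc n)
                  (trans (loaderNumber (f (suc zero)))
                    (trans (e (suc zero)) (trans (+-suc n 0) (cong suc (+-identityʳ n))))))))
        (cong (λ n → block (unary n) pushText) (trans (e zero) (+-identityʳ n))))
      (loader-text (suc n) vs (f ∘ suc)
        (λ j → trans (p (suc j)) (relabel-∘ f suc (loaderStep vs j)))
        (λ j → trans (e (suc j)) (+-suc n (toℕ j))))
      where
      pushText : BitString
      pushText = jumpText (suc n) (pushing 0F (bitSym w))

    startText haltText driverText : BitString
    startText = block (unary 0) (jumpText (2 + (size + 0)) waiting)
    haltText = block (unary 1) [ false ]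
    driverText = gather size (λ i → concatMap (driverRowText i) views)

    start-text : stateText zero ≡ startText
    start-text = block-text zero (jumpText (2 + (size + 0)) waiting) λ _ →
      commandText waiting (loaderIx ws zero) (2 + (size + 0)) (loaderNumber zero)

    halt-text : stateText (suc zero) ≡ haltText
    halt-text = block-text (suc zero) [ false ] (λ _ → refl)

    later-text : gather (size + #loader ws) (λ i → stateText (suc (suc i)))
                 ≡ driverText ++ loaderText (2 + (size + 0)) ws
    later-text = trans (gather-+ size (#loader ws) (λ i → stateText (suc (suc i))))
      (cong₂ _++_ (gather-cong size driver-text)
        (loader-text (2 + (size + 0)) ws id (λ j → sym (relabel-id (loaderStep ws j)))
          (λ j → cong (λ n → 2 + (n + toℕ j)) (sym (+-identityʳ size)))))

    rows-text : concatMap rowCode (cartesianProduct (allFin (#states ws)) views)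
                ≡ baseText ++ loaderText (2 + (size + 0)) ws
    rows-text = begin
      concatMap rowCode (cartesianProduct (allFin (#states ws)) views)
        ≡⟨ concatMap-cartesianProduct rowCode (allFin (#states ws)) views ⟩
      concatMap stateText (allFin (#states ws))
        ≡⟨ concatMap-tabulate (#states ws) stateText id ⟩
      stateText zero ++ stateText (suc zero) ++ gather (size + #loader ws) (λ i → stateText (suc (suc i)))
        ≡⟨ cong₂ _++_ start-text (cong₂ _++_ halt-text later-text) ⟩
      startText ++ haltText ++ driverText ++ loaderText (2 + (size + 0)) ws
        ≡⟨ cong (startText ++_) (++-assoc haltText driverText _) ⟨
      startText ++ (haltText ++ driverText) ++ loaderText (2 + (size + 0)) ws
        ≡⟨ ++-assoc startText (haltText ++ driverText) _ ⟨
      baseText ++ loaderText (2 + (size + 0)) ws ∎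
      where open ≡-Reasoning

    machine-text : machineCode ≡ machineText ws
    machine-text = trans (machineCode-views code (machine ws))
      (cong (λ t → unary 4 ++ unary 3 ++ unary (2 + (size + suc (length ws))) ++ t) rows-text)

  blockC : ∀ {A} {u v : ⟦ A ⟧ → BitString} →
           Computable A (list bool) u → Computable A (list bool) v →
           Computable A (list bool) (λ a → block (u a) (v a))
  blockC {u = u} {v} U V =
    viaC (foldC {b = λ (t , s , a) → s ++ u a ++ t ++ v a} (litC (map viewText views)) (litC [])
           (fstC (sndC idC) ++C (U ∘C sndC (sndC idC)) ++C fstC idC ++C (V ∘C sndC (sndC idC))))
         (λ a → foldl-++-concatMap (λ t → u a ++ t ++ v a) [] (map viewText views))

  pushText : Bool → BitString
  pushText w = actText (pushing 0F (bitSym w))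

  pushTextC : ∀ {A} {f : ⟦ A ⟧ → Bool} → Computable A bool f →
              Computable A (list bool) (λ a → pushText (f a))
  pushTextC {f = f} F = viaC (ifC F (litC (pushText true)) (litC (pushText false))) (λ a → choose (f a))
    where
    choose : ∀ w → (if w then pushText true else pushText false) ≡ pushText w
    choose true  = refl
    choose false = refl

  bootText : BitString
  bootText = jumpText (2 + toℕ (index (finite driver) (entry driver))) waiting

  -- Besides the text, the accumulator carries the unary code of the current loader state. Its
  -- successor is one prepended bit, so the fold needs no arithmetic.
  extend : Bool × (BitString × BitString) → BitString × BitString
  extend (w , u , s) = true ∷ u , s ++ block u (true ∷ (true ∷ u) ++ pushText w)

  finish : BitString × BitString → BitString
  finish (u , s) = s ++ block u bootText

  finish-foldl : ∀ n ws s → finish (foldl (λ z w → extend (w , z)) (unary n , s) ws)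
                            ≡ s ++ loaderText n ws
  finish-foldl n []       s = refl
  finish-foldl n (w ∷ ws) s =
    trans (finish-foldl (suc n) ws (s ++ block (unary n) (jumpText (suc n) (pushing 0F (bitSym w)))))
          (++-assoc s _ (loaderText (suc n) ws))

  extendC : ∀ {A} → Computable (bool ⊗ (list bool ⊗ list bool) ⊗ A) (list bool ⊗ list bool)
                               (λ (w , z , _) → extend (w , z))
  extendC {A} = (litC true ∷C u) ,C s ++C blockC u (litC true ∷C (litC true ∷C u) ++C pushTextC (fstC idC))
    where
    u = fstC (fstC (sndC (idC {bool ⊗ (list bool ⊗ list bool) ⊗ A})))
    s = sndC (fstC (sndC (idC {bool ⊗ (list bool ⊗ list bool) ⊗ A})))

  finishC : Computable (list bool ⊗ list bool) (list bool) finish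
  finishC = sndC idC ++C blockC (fstC idC) (litC bootText)

  loaderTextC : ∀ n → Computable (list bool) (list bool) (loaderText n)
  loaderTextC n = viaC (finishC ∘C foldC idC (litC (unary n , [])) extendC)
                       (λ ws → finish-foldl n ws [])

  lengthen : ∀ n (ws : List Bool) →
             foldl (λ u _ → true ∷ u) (unary n) ws ≡ unary (length ws + n)
  lengthen n []       = refl
  lengthen n (w ∷ ws) = trans (lengthen (suc n) ws) (cong unary (+-suc (length ws) n))

  statesC : Computable (list bool) (list bool) (λ ws → unary (2 + (size + suc (length ws))))
  statesC = viaC (foldC idC (litC (unary (3 + size))) (litC true ∷C fstC (sndC idC)))
    λ ws → trans (lengthen (3 + size) ws) (cong unary
      (trans (+-suc (length ws) (2 + size)) (cong suc (trans (+-suc (length ws) (suc size))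
        (cong suc (trans (+-comm (length ws) (suc size)) (sym (+-suc size (length ws)))))))))

  machineTextC : Computable (list bool) (list bool) machineText
  machineTextC =
    litC (unary 4) ++C litC (unary 3) ++C statesC ++C litC baseText ++C loaderTextC (2 + (size + 0))

  hardwiredC : Computable (list bool) (list bool)
                 (λ q → Encoding.machineCode code (machine (loaded q)))
  hardwiredC = viaC (machineTextC ∘C loadedC) (λ q → sym (machine-text (loaded q)))

-- An interpreter of machine codes

-- A configuration consists of state, position, output and tapes. States and symbols are kept in
-- their self-delimiting codes, so that a lookup in the table compares bit strings; the position is
-- a list of ones.
bits tapeTy confTy : Ty
bits   = list bool
tapeTy = list bits ⊗ bits ⊗ list bits
confTy = bits ⊗ bits ⊗ list bits ⊗ list tapeTy

module _ {A : Ty} where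

  -- Variables of the environments created by caseC and foldC.
  headC : ∀ {X} → Computable ((X ⊗ list X) ⊗ A) X (λ ((x , _) , _) → x)
  headC = fstC (fstC idC)

  tailC : ∀ {X} → Computable ((X ⊗ list X) ⊗ A) (list X) (λ ((_ , xs) , _) → xs)
  tailC = sndC (fstC idC)

  outerC : ∀ {X} → Computable ((X ⊗ list X) ⊗ A) A (λ (_ , a) → a)
  outerC = sndC idC

  itemC : ∀ {X B} → Computable (X ⊗ B ⊗ A) X (λ (x , _ , _) → x)
  itemC = fstC idC

  stateC : ∀ {X B} → Computable (X ⊗ B ⊗ A) B (λ (_ , s , _) → s)
  stateC = fstC (sndC idC)

  globalC : ∀ {X B} → Computable (X ⊗ B ⊗ A) A (λ (_ , _ , a) → a)
  globalC = sndC (sndC idC)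

tailOf : ∀ {X : Set} → List X → List X
tailOf xs = caseList xs [] (λ _ ys → ys)

tailOfC : ∀ {X} → Computable (list X) (list X) tailOf
tailOfC = caseC idC (litC []) tailC

splitStep : Bool × BitString × BitString → Bool × BitString × BitString
splitStep (found , u , r) =
  if found then (found , u , r)
  else caseList r (found , u , r) (λ b r′ → if b then (false , true ∷ u , r′) else (true , u , r′))

splitStepC : Computable (bool ⊗ bits ⊗ bits) (bool ⊗ bits ⊗ bits) splitStep
splitStepC = ifC (fstC idC) idC
  (caseC (sndC (sndC idC)) idC
    (ifC headC (litC false ,C (litC true ∷C fstC (sndC outerC)) ,C tailC)
               (litC true ,C fstC (sndC outerC) ,C tailC)))

-- The string serves as its own clock, being at least as long as its unary beginning. The
-- accumulator starts with the code of 0 and gains a bit for every one that is read.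
splitUnary : BitString → BitString × BitString
splitUnary r = proj₂ (foldl (λ z _ → splitStep z) (false , [ false ] , r) r)

splitUnaryC : Computable bits (bits ⊗ bits) splitUnary
splitUnaryC = sndC (foldC idC (litC false ,C litC [ false ] ,C idC) (splitStepC ∘C stateC))

cellOn : BitString × BitString → BitString
cellOn (w , p) = caseList p [ false ] (λ _ p′ →
  caseList (foldl (λ s _ → tailOf s) w p′) [ false ] (λ b _ → true ∷ b ∷ []))

cellOnC : Computable (bits ⊗ bits) bits cellOn
cellOnC = caseC (sndC idC) (litC [ false ])
  (caseC (foldC tailC (fstC outerC) (tailOfC ∘C stateC)) (litC [ false ])
    (litC true ∷C headC ∷C litC []))

Tapes Conf : Set
Tapes = List ⟦ tapeTy ⟧
Conf  = ⟦ confTy ⟧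

keyOf : BitString × Conf → BitString
keyOf (w , q , p , o , ts) = q ++ cellOn (w , p) ++ foldl (λ s t → s ++ proj₁ (proj₂ t)) [] ts

keyOfC : Computable (bits ⊗ confTy) bits keyOf
keyOfC = fstC (sndC idC) ++C cellOnC ∘C (fstC idC ,C fstC (sndC (sndC idC))) ++C
  foldC (sndC (sndC (sndC (sndC idC)))) (litC []) (stateC ++C fstC (sndC itemC))

matchStep : Bool × Bool × BitString → Bool × BitString
matchStep (k , ok , r) =
  if ok then caseList r (false , []) (λ b r′ → (if k then b else not b) , r′) else (ok , r)

notC : ∀ {A} {f : ⟦ A ⟧ → Bool} → Computable A bool f → Computable A bool (λ a → not (f a))
notC {f = f} F = viaC (ifC F (litC false) (litC true)) (λ a → flip (f a))
  where
  flip : ∀ b → (if b then false else true) ≡ not b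
  flip true  = refl
  flip false = refl

matchStepC : Computable (bool ⊗ bool ⊗ bits) (bool ⊗ bits) matchStep
matchStepC = ifC (fstC (sndC idC))
  (caseC (sndC (sndC idC)) (litC (false , []))
    (ifC (fstC outerC) headC (notC headC) ,C tailC))
  (sndC idC)

match : BitString × BitString → Bool × BitString
match (k , r) = foldl (λ z b → matchStep (b , z)) (true , r) k

matchC : Computable (bits ⊗ bits) (bool ⊗ bits) match
matchC = foldC (fstC idC) (litC true ,C sndC idC) (matchStepC ∘C (itemC ,C stateC))

goLeft goRight : BitString × ⟦ tapeTy ⟧ → ⟦ tapeTy ⟧
goLeft  (s , l , _ , r) = caseList l ([] , [ false ] , s ∷ r) (λ y l′ → l′ , y , s ∷ r)
goRight (s , l , _ , r) = caseList r (s ∷ l , [ false ] , []) (λ y r′ → s ∷ l , y , r′)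

goLeftC : Computable (bits ⊗ tapeTy) tapeTy goLeft
goLeftC = caseC (fstC (sndC idC))
  (litC [] ,C litC [ false ] ,C (fstC idC ∷C sndC (sndC (sndC idC))))
  (tailC ,C headC ,C (fstC outerC ∷C sndC (sndC (sndC outerC))))

goRightC : Computable (bits ⊗ tapeTy) tapeTy goRight
goRightC = caseC (sndC (sndC (sndC idC)))
  ((fstC idC ∷C fstC (sndC idC)) ,C litC [ false ] ,C litC [])
  ((fstC outerC ∷C fstC (sndC outerC)) ,C headC ,C tailC)

-- Like the other parsers it returns the unread rest of the string. Answers for strings that are not
-- codes are arbitrary and only make the function total.
moveBy : ⟦ tapeTy ⟧ × BitString × BitString → ⟦ tapeTy ⟧ × BitString
moveBy (t , s , r) = caseList r (t , []) (λ b r′ →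
  if b then caseList r′ (t , []) (λ d r″ → (if d then goRight (s , t) else goLeft (s , t)) , r″)
  else ((proj₁ t , s , proj₂ (proj₂ t)) , r′))

moveByC : Computable (tapeTy ⊗ bits ⊗ bits) (tapeTy ⊗ bits) moveBy
moveByC = caseC (sndC (sndC idC)) (fstC idC ,C litC [])
  (ifC headC
    (caseC tailC (fstC outerC ,C litC [])
      (ifC headC (goRightC ∘C written) (goLeftC ∘C written) ,C tailC))
    ((fstC (fstC outerC) ,C fstC (sndC outerC) ,C sndC (sndC (fstC outerC))) ,C tailC))
  where
  written : Computable ((bool ⊗ bits) ⊗ (bool ⊗ bits) ⊗ tapeTy ⊗ bits ⊗ bits) (bits ⊗ tapeTy)
              (λ (_ , _ , t , s , _) → s , t)
  written = fstC (sndC (sndC outerC)) ,C fstC (sndC outerC)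

operateBy : ⟦ tapeTy ⟧ × BitString → ⟦ tapeTy ⟧ × BitString
operateBy (t , r) = moveBy (t , splitUnary r)

operateByC : Computable (tapeTy ⊗ bits) (tapeTy ⊗ bits) operateBy
operateByC = moveByC ∘C (fstC idC ,C splitUnaryC ∘C sndC idC)

operateStep : ⟦ tapeTy ⟧ × Tapes × BitString → Tapes × BitString
operateStep (t , ts , r) = (ts ++ proj₁ (operateBy (t , r)) ∷ []) , proj₂ (operateBy (t , r))

operateStepC : Computable (tapeTy ⊗ list tapeTy ⊗ bits) (list tapeTy ⊗ bits) operateStep
operateStepC =
  (fstC (sndC idC) ++C fstC operated ∷C litC []) ,C sndC operated
  where
  operated = operateByC ∘C (fstC idC ,C sndC (sndC (idC {tapeTy ⊗ list tapeTy ⊗ bits})))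

operateAll : Tapes × BitString → Tapes × BitString
operateAll (ts , r) = foldl (λ z t → operateStep (t , z)) ([] , r) ts

operateAllC : Computable (list tapeTy ⊗ bits) (list tapeTy ⊗ bits) operateAll
operateAllC = foldC (fstC idC) (litC [] ,C sndC idC) (operateStepC ∘C (itemC ,C stateC))

skipCell : BitString → BitString
skipCell r = caseList r [] (λ b r′ → if b then tailOf r′ else r′)

skipCellC : Computable bits bits skipCell
skipCellC = caseC idC (litC []) (ifC headC (tailOfC ∘C tailC) tailC)

-- The list of tapes acts as a counter: a key holds one symbol code for each tape.
skipKey : Tapes × BitString → BitString
skipKey (ts , r) =
  foldl (λ s _ → proj₂ (splitUnary s)) (skipCell (proj₂ (splitUnary r))) ts

skipKeyC : Computable (list tapeTy ⊗ bits) bits skipKey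
skipKeyC = foldC (fstC idC) (skipCellC ∘C sndC (splitUnaryC ∘C sndC idC))
  (sndC (splitUnaryC ∘C stateC))

-- The parameter `out` splits off the code of one output symbol. It is the only part that depends on
-- the kind of machine: decompressors write bits, enumerators bits and separators, stopping machines
-- nothing.
module Interpreter (out : BitString → BitString × BitString)
                   (outC : Computable bits (bits ⊗ bits) out) where

  emitBy : List BitString × BitString → List BitString × BitString
  emitBy (o , r) = caseList r (o , []) (λ b r′ →
    if b then ((o ++ proj₁ (out r′) ∷ []) , proj₂ (out r′)) else (o , r′))

  emitByC : Computable (list bits ⊗ bits) (list bits ⊗ bits) emitBy
  emitByC = caseC (sndC idC) (fstC idC ,C litC [])
    (ifC headC ((fstC outerC ++C fstC (outC ∘C tailC) ∷C litC []) ,C sndC (outC ∘C tailC))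
               (fstC outerC ,C tailC))

  finishAct : BitString × BitString × Tapes × List BitString × BitString → Conf × BitString
  finishAct (q , p , ts , o , r) =
    (q , p , o , proj₁ (operateAll (ts , r))) , proj₂ (operateAll (ts , r))

  finishActC : Computable (bits ⊗ bits ⊗ list tapeTy ⊗ list bits ⊗ bits) (confTy ⊗ bits) finishAct
  finishActC = (fstC idC ,C fstC (sndC idC) ,C fstC (sndC (sndC (sndC idC))) ,C fstC operated)
    ,C sndC operated
    where
    operated = operateAllC ∘C (fstC (sndC (sndC (idC {bits ⊗ bits ⊗ list tapeTy ⊗ list bits ⊗ bits})))
                              ,C sndC (sndC (sndC (sndC idC))))

  advanceAct : Conf × BitString × BitString → Conf × BitString
  advanceAct ((q , p , o , ts) , q′ , r) = caseList r ((q , p , o , ts) , []) (λ b r′ →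
    finishAct (q′ , (if b then true ∷ p else p) , ts , emitBy (o , r′)))

  advanceActC : Computable (confTy ⊗ bits ⊗ bits) (confTy ⊗ bits) advanceAct
  advanceActC = caseC (sndC (sndC idC)) (fstC idC ,C litC [])
    (finishActC ∘C (fstC (sndC outerC)
      ,C ifC headC (litC true ∷C fstC (sndC (fstC outerC))) (fstC (sndC (fstC outerC)))
      ,C sndC (sndC (sndC (fstC outerC)))
      ,C emitByC ∘C (fstC (sndC (sndC (fstC outerC))) ,C tailC)))

  performBy : Conf × BitString → Conf × BitString
  performBy (c , r) = advanceAct (c , splitUnary r)

  performByC : Computable (confTy ⊗ bits) (confTy ⊗ bits) performBy
  performByC = advanceActC ∘C (fstC idC ,C splitUnaryC ∘C sndC idC)

  -- A list of at most one configuration stands for a Maybe.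
  decide : Conf × BitString → List Conf × BitString
  decide (c , r) = caseList r ([] , []) (λ b r′ →
    if b then (proj₁ (performBy (c , r′)) ∷ [] , proj₂ (performBy (c , r′))) else ([] , r′))

  decideC : Computable (confTy ⊗ bits) (list confTy ⊗ bits) decide
  decideC = caseC (sndC idC) (litC ([] , []))
    (ifC headC ((fstC performed ∷C litC []) ,C sndC performed) (litC [] ,C tailC))
    where
    performed = performByC ∘C (fstC (outerC {confTy ⊗ bits} {bool}) ,C tailC)

  readRow : Conf × BitString → List Conf × BitString
  readRow (c , r) = decide (c , skipKey (proj₂ (proj₂ (proj₂ c)) , r))

  readRowC : Computable (confTy ⊗ bits) (list confTy ⊗ bits) readRow
  readRowC = decideC ∘C (fstC idC ,C skipKeyC ∘C (sndC (sndC (sndC (fstC idC))) ,C sndC idC))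

  -- An action is skipped by performing it: every row is applied to c in order to find where the
  -- next row begins, and the outcome is kept only if the key matches.
  rowStep : (List Conf × BitString) × BitString × Conf → List Conf × BitString
  rowStep ((f , r) , k , c) = caseList r (f , r) (λ _ _ →
    (if proj₁ (match (k , r)) then proj₁ (readRow (c , r)) else f) , proj₂ (readRow (c , r)))

  rowStepC : Computable ((list confTy ⊗ bits) ⊗ bits ⊗ confTy) (list confTy ⊗ bits) rowStep
  rowStepC = caseC (sndC (fstC idC)) (fstC idC)
    ((ifC (fstC (matchC ∘C (fstC (sndC outerC) ,C sndC (fstC outerC))))
          (fstC row) (fstC (fstC outerC))) ,C sndC row)
    where
    row = readRowC ∘C
      (sndC (sndC (outerC {(list confTy ⊗ bits) ⊗ bits ⊗ confTy} {bool})) ,C sndC (fstC outerC))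

  -- The last row matching the key is used; the table itself bounds the number of rows.
  lookupRow : BitString × BitString × Conf → List Conf
  lookupRow (tbl , k , c) = proj₁ (foldl (λ z _ → rowStep (z , k , c)) ([] , tbl) tbl)

  lookupRowC : Computable (bits ⊗ bits ⊗ confTy) (list confTy) lookupRow
  lookupRowC = fstC (foldC (fstC idC) (litC [] ,C fstC idC) (rowStepC ∘C (stateC ,C sndC globalC)))

  stepBy : (BitString × BitString) × Conf → List Conf
  stepBy ((tbl , w) , c) = lookupRow (tbl , keyOf (w , c) , c)

  stepByC : Computable ((bits ⊗ bits) ⊗ confTy) (list confTy) stepBy
  stepByC = lookupRowC ∘C (fstC (fstC idC) ,C keyOfC ∘C (sndC (fstC idC) ,C sndC idC) ,C sndC idC)

  runStep : (Bool × Conf) × (BitString × BitString) → Bool × Conf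
  runStep ((h , c) , e) =
    if h then (h , c) else caseList (stepBy (e , c)) (true , c) (λ d _ → false , d)

  runStepC : Computable ((bool ⊗ confTy) ⊗ (bits ⊗ bits)) (bool ⊗ confTy) runStep
  runStepC = ifC (fstC (fstC idC)) (fstC idC)
    (caseC (stepByC ∘C (sndC idC ,C sndC (fstC idC))) (litC true ,C sndC (fstC idC))
      (litC false ,C headC))

  blankTapes : BitString → Tapes
  blankTapes = foldl (λ ts b → if b then ([] , [ false ] , []) ∷ ts else ts) []

  blankTapesC : Computable bits (list tapeTy) blankTapes
  blankTapesC = foldC idC (litC []) (ifC itemC (litC ([] , [ false ] , []) ∷C stateC) stateC)

  startConf : BitString → Conf
  startConf n = [ false ] , [] , [] , blankTapes n

  startConfC : Computable bits confTy startConf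
  startConfC = litC [ false ] ,C litC [] ,C litC [] ,C blankTapesC

  tableOf : BitString → BitString
  tableOf y = proj₂ (splitUnary (proj₂ (splitUnary (proj₂ (splitUnary y)))))

  tableOfC : Computable bits bits tableOf
  tableOfC = sndC (splitUnaryC ∘C sndC (splitUnaryC ∘C sndC (splitUnaryC ∘C idC)))

  -- t is a clock: only its length matters.
  runCode : BitString × BitString × BitString → Bool × Conf
  runCode (y , w , t) =
    foldl (λ z _ → runStep (z , tableOf y , w)) (false , startConf (proj₁ (splitUnary y))) t

  runCodeC : Computable (bits ⊗ bits ⊗ bits) (bool ⊗ confTy) runCode
  runCodeC = foldC (sndC (sndC idC))
    (litC false ,C startConfC ∘C fstC (splitUnaryC ∘C fstC idC))
    (runStepC ∘C (stateC ,C tableOfC ∘C fstC globalC ,C fstC (sndC globalC)))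

-- Bounded runs and correctness of the interpreter

splitStep-found : ∀ u r (xs : List Bool) →
                  foldl (λ z _ → splitStep z) (true , u , r) xs ≡ (true , u , r)
splitStep-found u r []       = refl
splitStep-found u r (_ ∷ xs) = splitStep-found u r xs

splitStep-unary : ∀ n k r → foldl (λ z _ → splitStep z) (false , unary k , unary n ++ r) (unary n ++ r)
                            ≡ (true , unary (n + k) , r)
splitStep-unary zero    k r = splitStep-found (unary k) r r
splitStep-unary (suc n) k r =
  trans (splitStep-unary n (suc k) r) (cong (λ m → true , unary m , r) (+-suc n k))

splitUnary-unary : ∀ n r → splitUnary (unary n ++ r) ≡ (unary n , r)
splitUnary-unary n r = trans (cong proj₂ (splitStep-unary n 0 r)) (cong (λ m → unary m , r) (+-identityʳ n))

unary-injective : ∀ m n → unary m ≡ unary n → m ≡ n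
unary-injective zero    zero    e = refl
unary-injective (suc m) (suc n) e = cong suc (unary-injective m n (cong tailOf e))
unary-injective zero    (suc n) ()
unary-injective (suc m) zero    ()

-- Unique decoding comes for free from the decoder: `splitUnary` recovers both parts from the
-- concatenation.
unary-prefix : ∀ m n {r s} → unary m ++ r ≡ unary n ++ s → m ≡ n × r ≡ s
unary-prefix m n {r} {s} e = unary-injective m n (cong proj₁ split) , cong proj₂ split
  where
  split : (unary m , r) ≡ (unary n , s)
  split = trans (sym (splitUnary-unary m r)) (trans (cong splitUnary e) (splitUnary-unary n s))

unary-cons : ∀ n r → ∃[ b ] ∃[ s ] unary n ++ r ≡ b ∷ s
unary-cons zero    r = _ , _ , refl
unary-cons (suc n) r = _ , _ , refl

foldl-tail : ∀ {A : Set} (w : List A) n → foldl (λ s _ → tailOf s) w (replicate n true) ≡ drop n w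
foldl-tail w       zero    = refl
foldl-tail []      (suc n) = trans (foldl-tail [] n) (drop-[] n)
foldl-tail (x ∷ w) (suc n) = foldl-tail w n

cellOn-position : ∀ w n → cellOn (w , replicate n true) ≡ maybeCode [_] (inputCell w n)
cellOn-position w zero = refl
cellOn-position w (suc n) rewrite foldl-tail w n with drop n w
... | []    = refl
... | _ ∷ _ = refl

matchStep-failed : ∀ k r → proj₁ (foldl (λ z b → matchStep (b , z)) (false , r) k) ≡ false
matchStep-failed []      r = refl
matchStep-failed (_ ∷ k) r = matchStep-failed k r

match-++ : ∀ k r → match (k , k ++ r) ≡ (true , r)
match-++ []          r = refl
match-++ (true ∷ k)  r = match-++ k r
match-++ (false ∷ k) r = match-++ k r

match-sound : ∀ k r → proj₁ (match (k , r)) ≡ true → r ≡ k ++ proj₂ (match (k , r))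
match-sound []          r           e = refl
match-sound (b ∷ k)     []          e with trans (sym (matchStep-failed k [])) e
... | ()
match-sound (true ∷ k)  (true ∷ r)  e = cong (true ∷_) (match-sound k r e)
match-sound (false ∷ k) (false ∷ r) e = cong (false ∷_) (match-sound k r e)
match-sound (true ∷ k)  (false ∷ r) e with trans (sym (matchStep-failed k r)) e
... | ()
match-sound (false ∷ k) (true ∷ r)  e with trans (sym (matchStep-failed k r)) e
... | ()

∈-vectors : ∀ {A : Set} {as : List A} → (∀ a → a ∈ as) → ∀ {n} (v : Vec A n) → v ∈ vectors as n
∈-vectors p []      = here refl
∈-vectors p (a ∷ v) = ∈-cartesianProductWith⁺ _∷_ (p a) (∈-vectors p v)

opaque
  unfolding viewsAt
  ∈-viewsAt : ∀ {s t} (v : Maybe Bool × Vec (Fin s) t) → v ∈ viewsAt s t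
  ∈-viewsAt (b , ss) = ∈-cartesianProduct⁺ (cell b) (∈-vectors ∈-allFin ss)
    where
    cell : ∀ b → b ∈ (nothing ∷ just false ∷ just true ∷ [])
    cell nothing      = here refl
    cell (just false) = there (here refl)
    cell (just true)  = there (there (here refl))

-- Runs cut off by a clock, determinism and locality

module Bounded {Γ : Set} (M : Machine Γ) where

  open Machine M
  open Run M

  advanceRun : Bool × Config → Maybe Command → Bool × Config
  advanceRun (true  , c) _        = true , c
  advanceRun (false , c) nothing  = true , c
  advanceRun (false , c) (just a) = false , perform a c

  runFrom : BitString → Bool × Config → BitString → Bool × Config
  runFrom w = foldl (λ z _ → advanceRun z (decision w (proj₂ z)))

  runFor : BitString → BitString → Bool × Config
  runFor w = runFrom w (false , initial)

  runFrom-path : ∀ w z t → Star (Step w) (proj₂ z) (proj₂ (runFrom w z t))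
  runFrom-path w z []      = ε
  runFrom-path w z (_ ∷ t) =
    advanced-path z (decision w (proj₂ z)) refl ◅◅ runFrom-path w _ t
    where
    advanced-path : ∀ z a → decision w (proj₂ z) ≡ a →
                    Star (Step w) (proj₂ z) (proj₂ (advanceRun z a))
    advanced-path (true  , c) a        e = ε
    advanced-path (false , c) nothing  e = ε
    advanced-path (false , c) (just a) e = (a , e , refl) ◅ ε

  runFrom-halted : ∀ w z t → (proj₁ z ≡ true → Halted w (proj₂ z)) →
                   proj₁ (runFrom w z t) ≡ true → Halted w (proj₂ (runFrom w z t))
  runFrom-halted w z []      h e = h e
  runFrom-halted w z (_ ∷ t) h e =
    runFrom-halted w _ t (advanced-halted z (decision w (proj₂ z)) refl h) e
    where
    advanced-halted : ∀ z a → decision w (proj₂ z) ≡ a → (proj₁ z ≡ true → Halted w (proj₂ z)) →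
                      proj₁ (advanceRun z a) ≡ true → Halted w (proj₂ (advanceRun z a))
    advanced-halted (true  , c) a        e h _ = h refl
    advanced-halted (false , c) nothing  e h _ = e
    advanced-halted (false , c) (just a) e h ()

  runFor-halted : ∀ w t → proj₁ (runFor w t) ≡ true → Halted w (proj₂ (runFor w t))
  runFor-halted w t = runFrom-halted w (false , initial) t (λ ())

  -- A long enough run has passed through d, but it need not end there: an enumerator goes on after
  -- listing a string.
  runFrom-follows : ∀ {w c d} → Star (Step w) c d →
    ∃[ n ] (∀ t → n ≤ length t → Star (Step w) d (proj₂ (runFrom w (false , c) t)))
  runFrom-follows {w} {c} ε = 0 , λ t _ → runFrom-path w (false , c) t
  runFrom-follows {w} ((a , e , refl) ◅ r) with runFrom-follows r
  ... | n , p = suc n , λ { (_ ∷ t) (s≤s le) →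
    subst (λ b → Star (Step w) _ (proj₂ (runFrom w (advanceRun (false , _) b) t))) (sym e) (p t le) }

  runFrom-true : ∀ w c t → runFrom w (true , c) t ≡ (true , c)
  runFrom-true w c []      = refl
  runFrom-true w c (_ ∷ t) = runFrom-true w c t

  step-unique : ∀ {w c d e} → Step w c d → Step w c e → d ≡ e
  step-unique (a , p , refl) (b , q , refl) with trans (sym p) q
  ... | refl = refl

  halted-unique : ∀ {w c d e} → Star (Step w) c d → Halted w d → Star (Step w) c e → Halted w e → d ≡ e
  halted-unique ε h ε g = refl
  halted-unique ε h ((a , p , _) ◅ _) g with trans (sym h) p
  ... | ()
  halted-unique ((a , p , _) ◅ _) h ε g with trans (sym g) p
  ... | ()
  halted-unique (s ◅ r) h (t ◅ q) g with step-unique s t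
  ... | refl = halted-unique r h q g

  step-position : ∀ {w c d} → Step w c d → position c ≤ position d
  step-position (action q true  o t , _ , refl) = n≤1+n _
  step-position (action q false o t , _ , refl) = ≤-refl

  path-position : ∀ {w c d} → Star (Step w) c d → position c ≤ position d
  path-position ε       = ≤-refl
  path-position (s ◅ r) = ≤-trans (step-position s) (path-position r)

  step-written : ∀ {w c d} → Step w c d → ∃[ z ] written d ≡ written c ++ z
  step-written {c = c} (action q a nothing  t , _ , refl) = [] , sym (++-identityʳ (written c))
  step-written {c = c} (action q a (just g) t , _ , refl) = [ g ] , refl

  path-written : ∀ {w c d} → Star (Step w) c d → ∃[ z ] written d ≡ written c ++ z
  path-written {c = c} ε = [] , sym (++-identityʳ (written c))
  path-written {c = c} (s ◅ r) with step-written s | path-written r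
  ... | y , e | z , f = y ++ z , trans f (trans (cong (_++ z) e) (++-assoc (written c) y z))

  decision-local : ∀ {u v} c → inputCell u (position c) ≡ inputCell v (position c) →
                   decision u c ≡ decision v c
  decision-local c e = cong (λ b → δ (state c) b (Vec.map Tape.scanned (memory c))) e

  -- Positions never decrease along a run, so a run that ends at a position of at most n has
  -- inspected no cell beyond n.
  path-local : ∀ {u v n} → (∀ i → i ≤ n → inputCell u i ≡ inputCell v i) →
               ∀ {c d} → Star (Step u) c d → position d ≤ n → Star (Step v) c d
  path-local p ε le = ε
  path-local p {c} (s@(a , e , f) ◅ r) le =
    (a , trans (sym (decision-local c (p _ (≤-trans (path-position (s ◅ r)) le)))) e , f)
      ◅ path-local p r le

  runFrom-halts : ∀ {u c d} → Star (Step u) c d → Halted u d →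
    ∃[ n ] (∀ w t → (∀ i → i ≤ position d → inputCell u i ≡ inputCell w i) → n ≤ length t →
            runFrom w (false , c) t ≡ (true , d))
  -- One tick after the last step is spent on noticing the halt.
  runFrom-halts {u} {c} ε h = 1 , λ { w (_ ∷ t) p _ →
    trans (cong (λ b → runFrom w (advanceRun (false , c) b) t)
                (trans (sym (decision-local c (p (position c) ≤-refl))) h))
          (runFrom-true w c t) }
  runFrom-halts {u} {c} ((a , e , refl) ◅ r) h with runFrom-halts r h
  ... | n , q = suc n , λ { w (_ ∷ t) p (s≤s le) →
    trans (cong (λ b → runFrom w (advanceRun (false , c) b) t)
                (trans (sym (decision-local c (p (position c)
                  (≤-trans (step-position {u} {c} (a , e , refl)) (path-position r))))) e))
          (q w t p le) }

  -- By determinism, the run to c and the rounds that follow h are parts of one run. As every round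
  -- takes at least one step, consuming the run to c step by step leads to a round that begins at c
  -- or later.
  reaches-invariant : ∀ {w} (I : Config → Set) →
    (∀ {c} → I c → ∃[ d ] (∃[ e ] Step w c e × Star (Step w) e d) × I d) →
    ∀ {a c h} → Star (Step w) a c → Star (Step w) a h → I h → ∃[ d ] Star (Step w) c d × I d
  reaches-invariant I next ε p i = _ , p , i
  reaches-invariant I next (s ◅ r) (t ◅ p) i with step-unique s t
  ... | refl = reaches-invariant I next r p i
  reaches-invariant I next (s ◅ r) ε i with next i
  ... | d , (e , t , q) , j with step-unique s t
  ... | refl = reaches-invariant I next r q j

inputCell-++ : ∀ u v i → i ≤ length u → inputCell u i ≡ inputCell (u ++ v) i
inputCell-++ u v zero    le = refl
inputCell-++ u v (suc i) le = head-drop u i le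
  where
  head-drop : ∀ (u : BitString) i → suc i ≤ length u → head (drop i u) ≡ head (drop i (u ++ v))
  head-drop (b ∷ u) zero    le       = refl
  head-drop (b ∷ u) (suc i) (s≤s le) = head-drop u i le

-- The interpreter on genuine machine codes

module Simulation {Γ : Set} (code : Γ → BitString)
                  (out : BitString → BitString × BitString)
                  (outC : Computable bits (bits ⊗ bits) out)
                  (out-code : ∀ g r → out (code g ++ r) ≡ (code g , r))
                  (M : Machine Γ) where

  open Machine M
  open Run M
  open Encoding code M
  open Interpreter out outC
  open Bounded M using (advanceRun; runFrom; runFor)

  tapeImage : Tape Symbol → ⟦ tapeTy ⟧
  tapeImage (tape l s r) = map finCode l , finCode s , map finCode r

  image : Config → Conf
  image (config q p o ts) =
    finCode q , replicate p true , map code o , map tapeImage (Vec.toList ts)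

  goLeft-image : ∀ s l z r → goLeft (finCode s , tapeImage (tape l z r))
                             ≡ tapeImage (moveHead zero left (tape l s r))
  goLeft-image s []      z r = refl
  goLeft-image s (y ∷ l) z r = refl

  goRight-image : ∀ s l z r → goRight (finCode s , tapeImage (tape l z r))
                              ≡ tapeImage (moveHead zero right (tape l s r))
  goRight-image s l z []      = refl
  goRight-image s l z (y ∷ r) = refl

  operateBy-work : ∀ t v r → operateBy (tapeImage t , workCode v ++ r)
                             ≡ (tapeImage (operate v t) , r)
  operateBy-work t@(tape l z y) v@(s , m) r = begin
    operateBy (tapeImage t , (finCode s ++ moveCode m) ++ r)
      ≡⟨ cong (λ u → operateBy (tapeImage t , u)) (++-assoc (finCode s) (moveCode m) r) ⟩
    operateBy (tapeImage t , finCode s ++ moveCode m ++ r)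
      ≡⟨ cong (λ u → moveBy (tapeImage t , u)) (splitUnary-unary (toℕ s) (moveCode m ++ r)) ⟩
    moveBy (tapeImage t , finCode s , moveCode m ++ r)
      ≡⟨ moved m ⟩
    tapeImage (operate v t) , r ∎
    where
    open ≡-Reasoning
    moved : ∀ m → moveBy (tapeImage t , finCode s , moveCode m ++ r) ≡ (tapeImage (operate (s , m) t) , r)
    moved left  = cong (_, r) (goLeft-image s l z y)
    moved stay  = refl
    moved right = cong (_, r) (goRight-image s l z y)

  operateAll-works : ∀ {n} (w : Vec (Symbol × Move) n) ts us r →
    foldl (λ z t → operateStep (t , z)) (us , concatMap workCode (Vec.toList w) ++ r)
          (map tapeImage (Vec.toList ts))
      ≡ (us ++ map tapeImage (Vec.toList (Vec.zipWith operate w ts)) , r)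
  operateAll-works []      []       us r = cong (_, r) (sym (++-identityʳ us))
  operateAll-works (v ∷ w) (t ∷ ts) us r = begin
    foldl f (operateStep (tapeImage t , us , (workCode v ++ concatMap workCode (Vec.toList w)) ++ r)) images
      ≡⟨ cong (λ u → foldl f (operateStep (tapeImage t , us , u)) images)
              (++-assoc (workCode v) (concatMap workCode (Vec.toList w)) r) ⟩
    foldl f (operateStep (tapeImage t , us , workCode v ++ later)) images
      ≡⟨ cong (λ p → foldl f ((us ++ proj₁ p ∷ []) , proj₂ p) images) (operateBy-work t v later) ⟩
    foldl f ((us ++ tapeImage (operate v t) ∷ []) , later) images
      ≡⟨ operateAll-works w ts (us ++ tapeImage (operate v t) ∷ []) r ⟩
    (us ++ tapeImage (operate v t) ∷ []) ++ results , r
      ≡⟨ cong (_, r) (++-assoc us (tapeImage (operate v t) ∷ []) results) ⟩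
    us ++ tapeImage (operate v t) ∷ results , r ∎
    where
    open ≡-Reasoning
    f : Tapes × BitString → ⟦ tapeTy ⟧ → Tapes × BitString
    f z t = operateStep (t , z)
    images = map tapeImage (Vec.toList ts)
    results = map tapeImage (Vec.toList (Vec.zipWith operate w ts))
    later = concatMap workCode (Vec.toList w) ++ r

  emitBy-output : ∀ o g r → emitBy (map code o , maybeCode code g ++ r)
                            ≡ (map code (appended g o) , r)
  emitBy-output o nothing  r = refl
  emitBy-output o (just g) r rewrite out-code g r = cong (_, r) (sym (map-++ code o [ g ]))

  advance-image : ∀ a p → (if a then true ∷ replicate p true else replicate p true)
                          ≡ replicate (advanced a p) true
  advance-image true  p = refl
  advance-image false p = refl

  performBy-action : ∀ c a r → performBy (image c , actionCode a ++ r) ≡ (image (perform a c) , r)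
  performBy-action c@(config q p o ts) (action q′ a g w) r = begin
    performBy (image c , actionCode (action q′ a g w) ++ r)
      ≡⟨ cong (λ u → performBy (image c , u)) assoc ⟩
    performBy (image c , finCode q′ ++ a ∷ maybeCode code g ++ works ++ r)
      ≡⟨ cong (λ u → advanceAct (image c , u)) (splitUnary-unary (toℕ q′) _) ⟩
    finishAct (finCode q′ , (if a then true ∷ replicate p true else replicate p true) , images ,
               emitBy (map code o , maybeCode code g ++ works ++ r))
      ≡⟨ cong₂ (λ p z → finishAct (finCode q′ , p , images , z))
               (advance-image a p) (emitBy-output o g (works ++ r)) ⟩
    finishAct (finCode q′ , replicate (advanced a p) true , images , map code (appended g o) , works ++ r)
      ≡⟨ cong (λ z → (finCode q′ , replicate (advanced a p) true ,
                      map code (appended g o) , proj₁ z) , proj₂ z)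
              (operateAll-works w ts [] r) ⟩
    image (perform (action q′ a g w) c) , r ∎
    where
    open ≡-Reasoning
    images = map tapeImage (Vec.toList ts)
    works = concatMap workCode (Vec.toList w)
    assoc : actionCode (action q′ a g w) ++ r ≡ finCode q′ ++ a ∷ maybeCode code g ++ works ++ r
    assoc = trans (++-assoc (finCode q′) _ r)
      (cong (λ u → finCode q′ ++ a ∷ u) (++-assoc (maybeCode code g) works r))

  View : Set
  View = State × Maybe Bool × Vec Symbol tapes

  symbolsCode : ∀ {n} → Vec Symbol n → BitString
  symbolsCode ss = concatMap finCode (Vec.toList ss)

  keyCode : View → BitString
  keyCode (q , b , ss) = finCode q ++ maybeCode [_] b ++ symbolsCode ss

  transition : View → Maybe Command
  transition (q , b , ss) = δ q b ss

  rowCode-key : ∀ v r → rowCode v ++ r ≡ keyCode v ++ maybeCode actionCode (transition v) ++ r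
  rowCode-key (q , b , ss) r = begin
    (finCode q ++ maybeCode [_] b ++ symbolsCode ss ++ act) ++ r
      ≡⟨ ++-assoc (finCode q) _ r ⟩
    finCode q ++ (maybeCode [_] b ++ symbolsCode ss ++ act) ++ r
      ≡⟨ cong (finCode q ++_) (++-assoc (maybeCode [_] b) _ r) ⟩
    finCode q ++ maybeCode [_] b ++ (symbolsCode ss ++ act) ++ r
      ≡⟨ cong (λ u → finCode q ++ maybeCode [_] b ++ u) (++-assoc (symbolsCode ss) act r) ⟩
    finCode q ++ maybeCode [_] b ++ symbolsCode ss ++ act ++ r
      ≡⟨ cong (finCode q ++_) (++-assoc (maybeCode [_] b) (symbolsCode ss) (act ++ r)) ⟨
    finCode q ++ (maybeCode [_] b ++ symbolsCode ss) ++ act ++ r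
      ≡⟨ ++-assoc (finCode q) _ (act ++ r) ⟨
    keyCode (q , b , ss) ++ act ++ r ∎
    where
    open ≡-Reasoning
    act = maybeCode actionCode (δ q b ss)

  skipCell-code : ∀ b r → skipCell (maybeCode [_] b ++ r) ≡ r
  skipCell-code nothing  r = refl
  skipCell-code (just b) r = refl

  skipSymbols : ∀ {n} (ss : Vec Symbol n) (ts : Vec (Tape Symbol) n) r →
    foldl (λ s _ → proj₂ (splitUnary s)) (symbolsCode ss ++ r) (map tapeImage (Vec.toList ts)) ≡ r
  skipSymbols []       []       r = refl
  skipSymbols (s ∷ ss) (t ∷ ts) r =
    trans (cong (λ u → foldl (λ s _ → proj₂ (splitUnary s)) u (map tapeImage (Vec.toList ts)))
            (trans (cong (proj₂ ∘ splitUnary) (++-assoc (finCode s) (symbolsCode ss) r))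
                   (cong proj₂ (splitUnary-unary (toℕ s) (symbolsCode ss ++ r)))))
          (skipSymbols ss ts r)

  skipKey-key : ∀ v (ts : Vec (Tape Symbol) tapes) r →
                skipKey (map tapeImage (Vec.toList ts) , keyCode v ++ r) ≡ r
  skipKey-key (q , b , ss) ts r =
    trans (cong (λ u → foldl (λ s _ → proj₂ (splitUnary s)) u (map tapeImage (Vec.toList ts))) skipped)
          (skipSymbols ss ts r)
    where
    skipped : skipCell (proj₂ (splitUnary (keyCode (q , b , ss) ++ r))) ≡ symbolsCode ss ++ r
    skipped = trans
      (cong (skipCell ∘ proj₂ ∘ splitUnary)
        (trans (++-assoc (finCode q) _ r)
               (cong (finCode q ++_) (++-assoc (maybeCode [_] b) (symbolsCode ss) r))))
      (trans (cong (skipCell ∘ proj₂) (splitUnary-unary (toℕ q) (maybeCode [_] b ++ symbolsCode ss ++ r)))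
             (skipCell-code b (symbolsCode ss ++ r)))

  result : Config → Maybe Command → List Conf
  result c nothing  = []
  result c (just a) = image (perform a c) ∷ []

  decide-action : ∀ c a r → decide (image c , maybeCode actionCode a ++ r) ≡ (result c a , r)
  decide-action c nothing  r = refl
  decide-action c (just a) r =
    cong (λ z → proj₁ z ∷ [] , proj₂ z) (performBy-action c a r)

  readRow-row : ∀ c v r → readRow (image c , rowCode v ++ r) ≡ (result c (transition v) , r)
  readRow-row c v r =
    trans (cong (λ u → readRow (image c , u)) (rowCode-key v r))
      (trans (cong (λ u → decide (image c , u)) (skipKey-key v (memory c) _))
             (decide-action c (transition v) r))

  symbolsCode-prefix : ∀ {n} (ss ss′ : Vec Symbol n) {r s} →
                       symbolsCode ss ++ r ≡ symbolsCode ss′ ++ s → ss ≡ ss′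
  symbolsCode-prefix []       []         e = refl
  symbolsCode-prefix (s ∷ ss) (s′ ∷ ss′) {r} {t} e
    with unary-prefix (toℕ s) (toℕ s′)
           (trans (sym (++-assoc (finCode s) (symbolsCode ss) r))
                  (trans e (++-assoc (finCode s′) (symbolsCode ss′) t)))
  ... | p , f = cong₂ _∷_ (toℕ-injective p) (symbolsCode-prefix ss ss′ f)

  cellCode-prefix : ∀ b b′ {r s} → maybeCode [_] b ++ r ≡ maybeCode [_] b′ ++ s → b ≡ b′ × r ≡ s
  cellCode-prefix nothing  nothing  refl = refl , refl
  cellCode-prefix (just b) (just _) refl = refl , refl
  cellCode-prefix nothing  (just _) ()
  cellCode-prefix (just _) nothing  ()

  -- All components are self-delimiting and the number of symbols is fixed, so keys form a prefix
  -- code, and matching a key against the beginning of a row cannot hit the row of another view.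
  keyCode-prefix : ∀ v v′ {r s} → keyCode v ++ r ≡ keyCode v′ ++ s → v ≡ v′
  keyCode-prefix (q , b , ss) (q′ , b′ , ss′) {r} {s} e
    with unary-prefix (toℕ q) (toℕ q′)
           (trans (sym (++-assoc (finCode q) _ r)) (trans e (++-assoc (finCode q′) _ s)))
  ... | p , f
    with cellCode-prefix b b′
           (trans (sym (++-assoc (maybeCode [_] b) (symbolsCode ss) r))
                  (trans f (++-assoc (maybeCode [_] b′) (symbolsCode ss′) s)))
  ... | refl , g = cong₂ _,_ (toℕ-injective p) (cong (b ,_) (symbolsCode-prefix ss ss′ g))

  rowStep-nonempty : ∀ f k c r → ∃[ b ] ∃[ s ] r ≡ b ∷ s → rowStep ((f , r) , k , c) ≡
    ((if proj₁ (match (k , r)) then proj₁ (readRow (c , r)) else f) , proj₂ (readRow (c , r)))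
  rowStep-nonempty f k c _ (b , s , refl) = refl

  rowCode-cons : ∀ v r → ∃[ b ] ∃[ s ] rowCode v ++ r ≡ b ∷ s
  rowCode-cons (q , b , ss) r with unary-cons (toℕ q) _
  ... | d , s , e = d , s , trans (++-assoc (finCode q) _ r) e

  rowStep-row : ∀ f v₀ v c r → rowStep ((f , rowCode v ++ r) , keyCode v₀ , image c) ≡
    ((if proj₁ (match (keyCode v₀ , rowCode v ++ r)) then result c (transition v) else f) , r)
  rowStep-row f v₀ v c r =
    trans (rowStep-nonempty f (keyCode v₀) (image c) (rowCode v ++ r) (rowCode-cons v r))
      (cong (λ z → (if proj₁ (match (keyCode v₀ , rowCode v ++ r)) then proj₁ z else f) , proj₂ z)
            (readRow-row c v r))

  -- Once the row of v₀ has been passed, f is right, and it stays right: by `keyCode-prefix` a later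
  -- match could only come from another row of v₀, with the same transition.
  rows-found : ∀ v₀ c (fuel : BitString) vs f → length vs ≤ length fuel →
    v₀ ∈ vs ⊎ f ≡ result c (transition v₀) →
    proj₁ (foldl (λ z _ → rowStep (z , keyCode v₀ , image c)) (f , concatMap rowCode vs) fuel)
      ≡ result c (transition v₀)
  rows-found v₀ c []         []       f le (inj₂ e) = e
  rows-found v₀ c (_ ∷ fuel) []       f le (inj₂ e) = rows-found v₀ c fuel [] f z≤n (inj₂ e)
  rows-found v₀ c (_ ∷ fuel) (v ∷ vs) f (s≤s le) known =
    trans (cong (λ z → proj₁ (foldl (λ z _ → rowStep (z , keyCode v₀ , image c)) z fuel))
                (rowStep-row f v₀ v c (concatMap rowCode vs)))
      (rows-found v₀ c fuel vs _ le (next _ refl known))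
    where
    next : ∀ ok → proj₁ (match (keyCode v₀ , rowCode v ++ concatMap rowCode vs)) ≡ ok →
           v₀ ∈ v ∷ vs ⊎ f ≡ result c (transition v₀) →
           v₀ ∈ vs ⊎ (if proj₁ (match (keyCode v₀ , rowCode v ++ concatMap rowCode vs))
                      then result c (transition v) else f) ≡ result c (transition v₀)
    next true e _ rewrite e
      with keyCode-prefix v v₀ (trans (sym (rowCode-key v (concatMap rowCode vs)))
             (match-sound (keyCode v₀) (rowCode v ++ concatMap rowCode vs) e))
    ... | refl = inj₂ refl
    next false e (inj₁ (there p)) = inj₁ p
    next false e (inj₂ p) rewrite e = inj₂ p
    next false e (inj₁ (here refl))
      with trans (sym (trans (cong (λ u → proj₁ (match (keyCode v₀ , u)))
                                   (rowCode-key v₀ (concatMap rowCode vs)))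
                             (cong proj₁ (match-++ (keyCode v₀) _)))) e
    ... | ()

  rows-length : ∀ vs → length vs ≤ length (concatMap rowCode vs)
  rows-length []       = z≤n
  rows-length (v ∷ vs) rewrite length-++ (rowCode v) {concatMap rowCode vs} =
    +-mono-≤ nonempty (rows-length vs)
    where
    nonempty : 1 ≤ length (rowCode v)
    nonempty = subst (λ u → 1 ≤ length u) (++-identityʳ (rowCode v)) (positive (rowCode-cons v []))
      where
      positive : ∀ {u : BitString} → ∃[ b ] ∃[ s ] u ≡ b ∷ s → 1 ≤ length u
      positive (_ , _ , refl) = s≤s z≤n

  allViews : List View
  allViews = cartesianProduct (allFin states) (viewsAt symbols tapes)

  lookupRow-all : ∀ v c → lookupRow (concatMap rowCode allViews , keyCode v , image c)
                          ≡ result c (transition v)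
  lookupRow-all v@(q , u) c = rows-found v c (concatMap rowCode allViews) allViews [] (rows-length allViews)
    (inj₁ (∈-cartesianProduct⁺ (∈-allFin q) (∈-viewsAt u)))

  scanned-code : ∀ {n} (ts : Vec (Tape Symbol) n) us →
    foldl (λ s t → s ++ proj₁ (proj₂ t)) us (map tapeImage (Vec.toList ts))
      ≡ us ++ symbolsCode (Vec.map Tape.scanned ts)
  scanned-code []       us = sym (++-identityʳ us)
  scanned-code (t ∷ ts) us =
    trans (scanned-code ts (us ++ finCode (Tape.scanned t))) (++-assoc us (finCode (Tape.scanned t)) _)

  viewOf : BitString → Config → View
  viewOf w c = state c , inputCell w (position c) , Vec.map Tape.scanned (memory c)

  keyOf-image : ∀ w c → keyOf (w , image c) ≡ keyCode (viewOf w c)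
  keyOf-image w (config q p o ts) =
    cong (finCode q ++_) (cong₂ _++_ (cellOn-position w p) (scanned-code ts []))

  tableOf-code : tableOf machineCode ≡ concatMap rowCode allViews
  tableOf-code = trans (cong tableOf (machineCode-views code M))
    (trans (cong (λ z → proj₂ (splitUnary (proj₂ (splitUnary (proj₂ z))))) (splitUnary-unary tapes _))
      (trans (cong (λ z → proj₂ (splitUnary (proj₂ z))) (splitUnary-unary symbols _))
        (cong proj₂ (splitUnary-unary states _))))

  stepBy-image : ∀ w c → stepBy ((tableOf machineCode , w) , image c) ≡ result c (decision w c)
  stepBy-image w c =
    trans (cong₂ (λ t k → lookupRow (t , k , image c)) tableOf-code (keyOf-image w c))
          (lookupRow-all (viewOf w c) c)

  imageRun : Bool × Config → Bool × Conf
  imageRun (h , c) = h , image c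

  runStep-image : ∀ w z → runStep (imageRun z , tableOf machineCode , w)
                          ≡ imageRun (advanceRun z (decision w (proj₂ z)))
  runStep-image w (true , c)  = refl
  runStep-image w (false , c) =
    trans (cong (λ l → caseList l (true , image c) (λ d _ → false , d)) (stepBy-image w c))
          (outcome (decision w c))
    where
    outcome : ∀ a → caseList (result c a) (true , image c) (λ d _ → false , d)
                    ≡ imageRun (advanceRun (false , c) a)
    outcome nothing  = refl
    outcome (just a) = refl

  runSteps-image : ∀ w z t → foldl (λ z _ → runStep (z , tableOf machineCode , w)) (imageRun z) t
                             ≡ imageRun (runFrom w z t)
  runSteps-image w z []      = refl
  runSteps-image w z (_ ∷ t) =
    trans (cong (λ y → foldl (λ z _ → runStep (z , tableOf machineCode , w)) y t) (runStep-image w z))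
          (runSteps-image w _ t)

  blankTapes-unary : ∀ n → blankTapes (unary n) ≡
                     map tapeImage (Vec.toList (Vec.replicate n (tape [] zero [])))
  blankTapes-unary n = trans (blanks n []) (++-identityʳ _)
    where
    blankTape : ⟦ tapeTy ⟧
    blankTape = [] , [ false ] , []

    images : ℕ → Tapes
    images n = map tapeImage (Vec.toList (Vec.replicate n (tape [] zero [])))

    snoc : ∀ n ts → images n ++ blankTape ∷ ts ≡ blankTape ∷ images n ++ ts
    snoc zero    ts = refl
    snoc (suc n) ts = cong (blankTape ∷_) (snoc n ts)

    blanks : ∀ n ts → foldl (λ ts b → if b then blankTape ∷ ts else ts) ts (unary n) ≡ images n ++ ts
    blanks zero    ts = refl
    blanks (suc n) ts = trans (blanks n (blankTape ∷ ts)) (snoc n ts)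

  runCode-image : ∀ w t → runCode (machineCode , w , t) ≡ imageRun (runFor w t)
  runCode-image w t =
    trans (cong (λ n → foldl (λ z _ → runStep (z , tableOf machineCode , w)) (false , startConf n) t)
            (trans (cong (proj₁ ∘ splitUnary) (machineCode-views code M))
                   (cong proj₁ (splitUnary-unary tapes _))))
      (trans (cong (λ ts → foldl (λ z _ → runStep (z , tableOf machineCode , w))
                                 (false , [ false ] , [] , [] , ts) t) (blankTapes-unary tapes))
             (runSteps-image w (false , initial) t))

-- Machines that compute a given function

orderTy : Ty → Ty
orderTy S = bool ⊗ bool ⊗ bool ⊗ bool ⊗ S

copierTy : Ty
copierTy = bool ⊗ bool ⊗ bits

-- The flags say whether the head has entered the input and whether the output has begun.
copierRound : (BitString → BitString) → BitString × ⟦ copierTy ⟧ → ⟦ orderTy copierTy ⟧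
copierRound f (cell , started , answering , u) =
  if answering
  then caseList u (true , false , false , false , true , true , [])
                  (λ b v → false , false , true , b , true , true , v)
  else if started
  then caseList cell (false , false , false , false , true , true , f (reverse u))
                     (λ b _ → false , true , false , false , true , false , b ∷ u)
  else (false , true , false , false , true , false , u)

copierRoundC : ∀ {f} → Computable bits bits f →
               Computable (bits ⊗ copierTy) (orderTy copierTy) (copierRound f)
copierRoundC F = ifC (fstC (sndC (sndC idC)))
  (caseC (sndC (sndC (sndC idC))) (litC (true , false , false , false , true , true , []))
    (litC false ,C litC false ,C litC true ,C headC ,C litC true ,C litC true ,C tailC))
  (ifC (fstC (sndC idC))
    (caseC (fstC idC)
      (litC false ,C litC false ,C litC false ,C litC false ,C litC true ,C litC true
        ,C F ∘C reverseC (sndC (sndC (sndC idC))))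
      (litC false ,C litC true ,C litC false ,C litC false ,C litC true ,C litC false
        ,C (headC ∷C sndC (sndC (sndC outerC)))))
    (litC false ,C litC true ,C litC false ,C litC false ,C litC true ,C litC false
      ,C sndC (sndC (sndC idC))))

cell-after : ∀ u v → inputCell (u ++ v) (suc (length u)) ≡ head v
cell-after []      v = refl
cell-after (b ∷ u) v = cell-after u v

-- The round is represented by an arbitrary term R, since the argument appeals only to its
-- correctness.
module Copier (f : BitString → BitString)
              (R : Computable (bits ⊗ copierTy) (orderTy copierTy) (copierRound f)) where

  program : Program Bool
  program .Program.S            = copierTy
  program .Program.output e b   = if e then just b else nothing
  program .Program.init         = lit (false , false , [])
  program .Program.round        = term R

  open Hardwired program using (machine; AtHead; starts; continue; halt; plus→star)

  decompressor : Decompressor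
  decompressor = machine (loaded [])

  module _ (x : BitString) where

    open Run decompressor

    Answers : BitString → Config → Set
    Answers y c = ∃[ d ] Star (Step x) c d × Halted x d × written d ≡ y

    Head : ⟦ copierTy ⟧ → ℕ → List Bool → Config → Set
    Head = AtHead (loaded []) x

    answers-later : ∀ {s i o c a e b s′ y} → Head s i o c →
      copierRound f (cellBits (inputCell x i) , s) ≡ (false , a , e , b , s′) →
      (∀ {d} → Head s′ (advancedTo a i) (appendedTo (if e then just b else nothing) o) d →
               Answers y d) →
      Answers y c
    answers-later {a = a} {e} {b} {s′} h eq k =
      let d , p , h′ = continue (loaded []) x h (trans (correct R _) eq)
          d′ , q , z = k h′
      in d′ , plus→star (loaded []) x p ◅◅ q , z

    answering : ∀ v {i o c} → Head (true , true , v) i o c → Answers (o ++ v) c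
    answering [] {o = o} h =
      let d , p , q , _ , e = halt (loaded []) x h (correct R _)
      in d , p , q , trans e (sym (++-identityʳ o))
    answering (b ∷ v) {o = o} h =
      subst (λ y → Answers y _) (++-assoc o [ b ] v) (answers-later h refl (answering v))

    reading : ∀ u v → x ≡ u ++ v → ∀ {c} →
              Head (true , false , reverse u) (suc (length u)) [] c → Answers (f x) c
    reading u [] refl h = answers-later h
      (trans (cong (λ b → copierRound f (cellBits b , true , false , reverse u)) (cell-after u []))
             (cong (λ w → false , false , false , false , true , true , f w)
                   (trans (reverse-involutive u) (sym (++-identityʳ u)))))
      (answering (f (u ++ [])))
    reading u (b ∷ v) refl h = answers-later h
      (trans (cong (λ d → copierRound f (cellBits d , true , false , reverse u)) (cell-after u (b ∷ v)))
             (cong (λ w → false , true , false , false , true , false , w) (sym (reverse-++ u [ b ]))))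
      (λ h → reading (u ∷ʳ b) v (sym (++-assoc u [ b ] v))
               (subst (λ n → Head (true , false , reverse (u ∷ʳ b)) (suc n) [] _)
                      (sym (trans (length-++ u) (+-comm (length u) 1))) h))

    decompresses : Decompresses decompressor x (f x)
    decompresses =
      let c , r , h     = starts (loaded []) x [] refl
          d , p , q , e = answers-later h refl (reading [] x refl)
      in d , r ◅◅ p , q , e

-- Searching an enumeration for an extension of the bits read

outBit : BitString → BitString × BitString
outBit r = caseList r ([] , []) (λ b r′ → b ∷ [] , r′)

outBitC : Computable bits (bits ⊗ bits) outBit
outBitC = caseC idC (litC ([] , [])) ((headC ∷C litC []) ,C tailC)

outMaybe : BitString → BitString × BitString
outMaybe r = caseList r ([] , []) (λ e r′ →
  if e then caseList r′ ([] , []) (λ b r″ → true ∷ b ∷ [] , r″) else ([ false ] , r′))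

outMaybeC : Computable bits (bits ⊗ bits) outMaybe
outMaybeC = caseC idC (litC ([] , []))
  (ifC headC (caseC tailC (litC ([] , [])) ((litC true ∷C headC ∷C litC []) ,C tailC))
             (litC [ false ] ,C tailC))

outMaybe-code : ∀ g r → outMaybe (maybeCode [_] g ++ r) ≡ (maybeCode [_] g , r)
outMaybe-code nothing  r = refl
outMaybe-code (just b) r = refl

joined : List BitString → BitString
joined = foldl (λ s o → s ++ o) []

joinedC : Computable (list bits) bits joined
joinedC = foldC idC (litC []) (stateC ++C itemC)

joined-singletons : ∀ y → joined (map [_] y) ≡ y
joined-singletons y = after [] y
  where
  after : ∀ s y → foldl (λ s o → s ++ o) s (map [_] y) ≡ s ++ y
  after s []      = sym (++-identityʳ s)
  after s (b ∷ y) = trans (after (s ++ [ b ]) y) (++-assoc s [ b ] y)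

isEmpty : BitString → Bool
isEmpty r = caseList r true (λ _ _ → false)

isEmptyC : Computable bits bool isEmpty
isEmptyC = caseC idC (litC true) (litC false)

check : BitString × BitString × Bool × Bool → Bool × Bool
check (u , v , z) = if proj₁ (match (u , v)) then (true , isEmpty (proj₂ (match (u , v)))) else z

checkC : Computable (bits ⊗ bits ⊗ bool ⊗ bool) (bool ⊗ bool) check
checkC = ifC (fstC matched) (litC true ,C isEmptyC ∘C sndC matched) (sndC (sndC idC))
  where
  matched = matchC ∘C (fstC idC ,C fstC (sndC (idC {bits ⊗ bits ⊗ bool ⊗ bool})))

scanStep : BitString × (BitString × Bool × Bool) × BitString → BitString × Bool × Bool
scanStep (o , (v , z) , u) = caseList o (v , z) (λ e o′ →
  if e then caseList o′ (v , z) (λ b _ → (v ++ b ∷ []) , z) else ([] , check (u , v , z)))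

scanStepC : Computable (bits ⊗ (bits ⊗ bool ⊗ bool) ⊗ bits) (bits ⊗ bool ⊗ bool) scanStep
scanStepC = caseC (fstC idC) (fstC (sndC idC))
  (ifC headC
    (caseC tailC (fstC (sndC outerC))
      ((fstC (fstC (sndC (sndC outerC))) ++C headC ∷C litC []) ,C sndC (fstC (sndC (sndC outerC)))))
    (litC [] ,C checkC ∘C (sndC (sndC outerC) ,C fstC outerC′ ,C sndC outerC′)))
  where
  outerC′ = fstC (sndC (outerC {bits ⊗ (bits ⊗ bool ⊗ bool) ⊗ bits} {bool}))

-- The second flag says whether the last extension of u found is u itself.
scan : BitString × List BitString → Bool × Bool
scan (u , os) = proj₂ (foldl (λ z o → scanStep (o , z , u)) ([] , false , false) os)

scanC : Computable (bits ⊗ list bits) (bool ⊗ bool) scan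
scanC = sndC (foldC (sndC idC) (litC ([] , false , false)) (scanStepC ∘C (itemC ,C stateC ,C fstC globalC)))

checkAll : BitString → Bool × Bool → List BitString → Bool × Bool
checkAll u = foldl (λ z v → check (u , v , z))

scan-terminated : ∀ u v z os →
  proj₂ (foldl (λ z o → scanStep (o , z , u)) (v , z) (map (maybeCode [_]) os))
    ≡ checkAll u z (terminated v os)
scan-terminated u v z []             = refl
scan-terminated u v z (just b ∷ os)  = scan-terminated u (v ∷ʳ b) z os
scan-terminated u v z (nothing ∷ os) = scan-terminated u [] (check (u , v , z)) os

-- A later extension of u overrides an earlier one, so the induction consults the tail first. It is
-- left open which extension is reported: in a prefix-free set, u and a proper extension of u are
-- never both listed.
checkAll-outcome : ∀ u z vs →
  (checkAll u z vs ≡ z × (∀ s → u ++ s ∉ vs))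
  ⊎ ∃[ s ] u ++ s ∈ vs × checkAll u z vs ≡ (true , isEmpty s)
checkAll-outcome u z []       = inj₁ (refl , λ s ())
checkAll-outcome u z (v ∷ vs) with checkAll-outcome u (check (u , v , z)) vs
... | inj₂ (s , p , e) = inj₂ (s , there p , e)
... | inj₁ (e , none) = inspect (proj₁ (match (u , v))) refl
  where
  inspect : ∀ ok → proj₁ (match (u , v)) ≡ ok →
    (checkAll u z (v ∷ vs) ≡ z × (∀ s → u ++ s ∉ v ∷ vs))
    ⊎ ∃[ s ] u ++ s ∈ v ∷ vs × checkAll u z (v ∷ vs) ≡ (true , isEmpty s)
  inspect true  p = inj₂ (proj₂ (match (u , v)) , here (sym (match-sound u v p)) ,
    trans e (cong (λ b → if b then (true , isEmpty (proj₂ (match (u , v)))) else z) p))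
  inspect false p = inj₁
    (trans e (cong (λ b → if b then (true , isEmpty (proj₂ (match (u , v)))) else z) p) , λ
    { s (here refl) → case-⊥ (trans (sym (cong proj₁ (match-++ u s))) p)
    ; s (there q)   → none s q })
    where
    case-⊥ : true ≡ false → ⊥
    case-⊥ ()

∈-terminated-++ : ∀ {x} u o z → x ∈ terminated u o → x ∈ terminated u (o ++ z)
∈-terminated-++ u (just b ∷ o)  z p         = ∈-terminated-++ (u ∷ʳ b) o z p
∈-terminated-++ u (nothing ∷ o) z (here e)  = here e
∈-terminated-++ u (nothing ∷ o) z (there p) = there (∈-terminated-++ [] o z p)

prefix-++ : ∀ (u v : BitString) → Prefix _≡_ u (u ++ v)
prefix-++ []      v = []
prefix-++ (b ∷ u) v = refl ∷ prefix-++ u v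

readerTy : Ty
readerTy = bool ⊗ bits ⊗ bits ⊗ bits

-- Decoding the description and searching the enumeration

module Decoding (U : Decompressor) where

  open Simulation [_] outBit outBitC (λ g r → refl) U
  open Interpreter outBit outBitC using (runCode; runCodeC)
  open Bounded U
  open Run U

  code : BitString
  code = Encoding.machineCode [_] U

  yielded : Bool × Conf → List BitString
  yielded (h , _ , _ , o , _) = if h then joined o ∷ [] else []

  yieldedC : Computable (bool ⊗ confTy) (list bits) yielded
  yieldedC = ifC (fstC idC) ((joinedC ∘C fstC (sndC (sndC (sndC idC)))) ∷C litC []) (litC [])

  outputOf : Bool × Config → List BitString
  outputOf (h , c) = if h then written c ∷ [] else []

  opaque
    -- Empty if U has not halted on q within |t| steps.
    decoded : BitString × BitString → List BitString
    decoded (q , t) = yielded (runCode (code , q , t))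

    decodedC : Computable (bits ⊗ bits) (list bits) decoded
    decodedC = yieldedC ∘C runCodeC ∘C (litC code ,C fstC idC ,C sndC idC)

    decoded-run : ∀ q t → decoded (q , t) ≡ outputOf (runFor q t)
    decoded-run q t =
      trans (cong yielded (runCode-image q t))
        (cong (λ y → if proj₁ (runFor q t) then y ∷ [] else [])
              (joined-singletons (written (proj₂ (runFor q t)))))

  decoded-complete : ∀ {q y} → Decompresses U q y →
                     ∃[ n ] (∀ t → n ≤ length t → decoded (q , t) ≡ y ∷ [])
  decoded-complete {q} (c , r , h , refl) with runFrom-halts r h
  ... | n , p = n , λ t le → trans (decoded-run q t) (cong outputOf (p q t (λ _ _ → refl) le))

  decoded-sound : ∀ {q y} → Decompresses U q y → ∀ t →
                  decoded (q , t) ≡ [] ⊎ decoded (q , t) ≡ y ∷ []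
  decoded-sound {q} (c , r , h , refl) t = go (proj₁ (runFor q t)) refl
    where
    go : ∀ b → proj₁ (runFor q t) ≡ b →
         decoded (q , t) ≡ [] ⊎ decoded (q , t) ≡ written c ∷ []
    go false e = inj₁ (trans (decoded-run q t)
      (cong (λ b → if b then written (proj₂ (runFor q t)) ∷ [] else []) e))
    go true  e = inj₂ (trans (decoded-run q t)
      (trans (cong (λ b → if b then written (proj₂ (runFor q t)) ∷ [] else []) e)
        (cong (λ d → written d ∷ [])
          (halted-unique (runFrom-path q (false , initial) t) (runFor-halted q t e) r h))))

  open Interpreter outMaybe outMaybeC using () renaming (runCode to runEnumerator; runCodeC to runEnumeratorC)

  emittedOf : Bool × Conf → List BitString
  emittedOf (_ , _ , _ , o , _) = o

  opaque
    scanRun : BitString × BitString × BitString → Bool × Bool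
    scanRun (u , t , y) = scan (u , emittedOf (runEnumerator (y , [] , t)))

    scanRunC : Computable (bits ⊗ bits ⊗ bits) (bool ⊗ bool) scanRun
    scanRunC = scanC ∘C (fstC idC ,C fstC (sndC (sndC (sndC
      (runEnumeratorC ∘C (sndC (sndC idC) ,C litC [] ,C fstC (sndC idC)))))))

    scanRun-listed : ∀ E u t → scanRun (u , t , enumeratorCode E) ≡
      checkAll u (false , false) (terminated [] (Run.written (proj₂ (Bounded.runFor E [] t))))
    scanRun-listed E u t =
      trans (cong (λ z → scan (u , emittedOf z))
                  (Simulation.runCode-image (maybeCode [_]) outMaybe outMaybeC outMaybe-code E [] t))
            (scan-terminated u [] (false , false) (Run.written (proj₂ (Bounded.runFor E [] t))))

  search : BitString × BitString × BitString → Bool × Bool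
  search (u , q , t) = caseList (decoded (q , t)) (false , false) (λ y _ → scanRun (u , t , y))

  searchC : Computable (bits ⊗ bits ⊗ bits) (bool ⊗ bool) search
  searchC = caseC (decodedC ∘C (fstC (sndC idC) ,C sndC (sndC idC))) (litC (false , false))
    (scanRunC ∘C (fstC outerC ,C sndC (sndC outerC) ,C headC))

  -- The flag says that the head has just moved to a bit not yet appended to u.
  readerRound : BitString × ⟦ readerTy ⟧ → ⟦ orderTy readerTy ⟧
  readerRound (cell , fresh , t , u , q) =
    if fresh then (false , false , false , false , false , t , (u ++ cell) , q)
    else if proj₁ (search (u , q , t))
         then (if proj₂ (search (u , q , t))
               then (true , false , false , false , false , t , u , q)
               else (false , true , false , false , true , t , u , q))
         else (false , false , false , false , false , true ∷ t , u , q)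

  readerRoundC : Computable (bits ⊗ readerTy) (orderTy readerTy) readerRound
  readerRoundC = ifC (fstC (sndC idC))
    (litC false ,C litC false ,C litC false ,C litC false ,C litC false ,C t ,C (u ++C fstC idC) ,C q)
    (ifC (fstC found)
      (ifC (sndC found)
        (litC true ,C litC false ,C litC false ,C litC false ,C litC false ,C t ,C u ,C q)
        (litC false ,C litC true ,C litC false ,C litC false ,C litC true ,C t ,C u ,C q))
      (litC false ,C litC false ,C litC false ,C litC false ,C litC false ,C (litC true ∷C t) ,C u ,C q))
    where
    s = sndC (sndC (idC {bits ⊗ readerTy}))
    t = fstC s
    u = fstC (sndC s)
    q = sndC (sndC s)
    found = searchC ∘C (u ,C q ,C t)

  module Searching (E : Enumerator) (q : BitString) (D : Decompresses U q (enumeratorCode E)) where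

    private
      module B = Bounded E
      module R = Run E

    listed : BitString → List BitString
    listed t = terminated [] (R.written (proj₂ (B.runFor [] t)))

    search-listed : ∀ u t → decoded (q , t) ≡ enumeratorCode E ∷ [] →
                    search (u , q , t) ≡ checkAll u (false , false) (listed t)
    search-listed u t e =
      trans (cong (λ l → caseList l (false , false) (λ y _ → scanRun (u , t , y))) e)
            (scanRun-listed E u t)

    search-none : ∀ u t → decoded (q , t) ≡ [] → search (u , q , t) ≡ (false , false)
    search-none u t = cong (λ l → caseList l (false , false) (λ y _ → scanRun (u , t , y)))

    listed-sound : ∀ t {v} → v ∈ listed t → Lists E v
    listed-sound t p = _ , B.runFrom-path [] (false , R.initial) t , p

    listed-complete : ∀ {v} → Lists E v → ∃[ n ] (∀ t → n ≤ length t → v ∈ listed t)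
    listed-complete {v} (c , r , p) with B.runFrom-follows r
    ... | n , follows = n , λ t le →
      let z , e = B.path-written (follows t le)
      in subst (λ o → v ∈ terminated [] o) (sym e) (∈-terminated-++ [] (R.written c) z p)

    -- Failure carries information as well: it is possible only while the clock t is shorter than n.
    Outcome : ℕ → BitString → BitString → Set
    Outcome n u t =
      (search (u , q , t) ≡ (false , false) × (n ≤ length t → ⊥))
      ⊎ ∃[ s ] Lists E (u ++ s) × search (u , q , t) ≡ (true , isEmpty s)

    -- One bound serves all prefixes u of x: when q has been decoded and x has been listed, x itself
    -- is an extension of u to be found.
    search-outcome : ∀ {x} → Lists E x → ∃[ n ] (∀ u v t → x ≡ u ++ v → Outcome n u t)
    search-outcome {x} l = n ⊔ n′ , λ u v t e → byDecoding u v t e (decoded-sound D t)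
      where
      n  = proj₁ (decoded-complete D)
      n′ = proj₁ (listed-complete l)

      nonempty : ∀ {ys : List BitString} {y} → ys ≡ [] → ys ≡ y ∷ [] → ⊥
      nonempty refl ()

      byListing : ∀ u v t → x ≡ u ++ v → decoded (q , t) ≡ enumeratorCode E ∷ [] →
        (checkAll u (false , false) (listed t) ≡ (false , false) × (∀ s → u ++ s ∉ listed t))
        ⊎ ∃[ s ] u ++ s ∈ listed t × checkAll u (false , false) (listed t) ≡ (true , isEmpty s) →
        Outcome (n ⊔ n′) u t
      byListing u v t e d (inj₁ (f , none)) = inj₁ (trans (search-listed u t d) f , λ le →
        none v (subst (_∈ listed t) e (proj₂ (listed-complete l) t (≤-trans (m≤n⊔m n n′) le))))
      byListing u v t e d (inj₂ (s , p , f)) =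
        inj₂ (s , listed-sound t p , trans (search-listed u t d) f)

      byDecoding : ∀ u v t → x ≡ u ++ v →
        decoded (q , t) ≡ [] ⊎ decoded (q , t) ≡ enumeratorCode E ∷ [] → Outcome (n ⊔ n′) u t
      byDecoding u v t e (inj₁ d) = inj₁ (search-none u t d , λ le →
        nonempty d (proj₂ (decoded-complete D) t (≤-trans (m≤m⊔n n n′) le)))
      byDecoding u v t e (inj₂ d) =
        byListing u v t e d (checkAll-outcome u (false , false) (listed t))

-- From an enumerator to a stopping machine

module Reader (U : Decompressor)
  (R : Computable (bits ⊗ readerTy) (orderTy readerTy) (Decoding.readerRound U)) where

  open Decoding U

  program : Program ⊥
  program .Program.S          = readerTy
  program .Program.output _ _ = nothing
  program .Program.init       = ⟨ lit false , ⟨ lit [] , ⟨ lit [] , idn ⟩ ⟩ ⟩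
  program .Program.round      = term R

  open Hardwired program using (machine; AtHead; starts; continue; halt; plus→star)

  module _ (E : Enumerator) (q : BitString) (D : Decompresses U q (enumeratorCode E))
           (S : Pred BitString 0ℓ) (enumerates : Enumerates E S) (prefixFree : PrefixFree S)
           (x : BitString) (Sx : S x) where

    open Searching E q D

    stopper : Stopper
    stopper = machine (loaded q)

    open Run stopper

    Stops : Config → Set
    Stops c = ∃[ d ] Star (Step x) c d × Halted x d × position d ≡ length x

    Head : ⟦ readerTy ⟧ → ℕ → List ⊥ → Config → Set
    Head = AtHead (loaded q) x

    stops-later : ∀ {s i o c a s′} → Head s i o c →
      readerRound (cellBits (inputCell x i) , s) ≡ (false , a , false , false , s′) →
      (∀ {d} → Head s′ (advancedTo a i) o d → Stops d) → Stops c
    stops-later {a = a} {s′} h eq k =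
      let d , p , h′ = continue (loaded q) x h (trans (correct R _) eq)
          d′ , z     = k h′
      in d′ , plus→star (loaded q) x p ◅◅ proj₁ z , proj₂ z

    stops-now : ∀ {s i o c r} → Head s i o c → i ≡ length x →
      readerRound (cellBits (inputCell x i) , s) ≡ (true , r) → Stops c
    stops-now h e eq =
      let d , p , h′ , f , _ = halt (loaded q) x h (trans (correct R _) eq)
      in d , p , h′ , trans f e

    bound : ℕ
    bound = proj₁ (search-outcome (Equivalence.from (enumerates x) Sx))

    outcome : ∀ u v t → x ≡ u ++ v → Outcome bound u t
    outcome = proj₂ (search-outcome (Equivalence.from (enumerates x) Sx))

    no-extension : ∀ u b v → S u → S (u ++ b ∷ v) → ⊥
    no-extension u b v p r = prefixFree u (u ++ b ∷ v) p r (prefix-++ u (b ∷ v) , distinct)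
      where
      distinct : u ≢ u ++ b ∷ v
      distinct e with ++-cancelˡ u [] (b ∷ v) (trans (++-identityʳ u) e)
      ... | ()

    round-search : ∀ {t u z} cell → search (u , q , t) ≡ z →
      readerRound (cell , false , t , u , q) ≡
        (if proj₁ z
         then (if proj₂ z
               then (true , false , false , false , false , t , u , q)
               else (false , true , false , false , true , t , u , q))
         else (false , false , false , false , false , true ∷ t , u , q))
    round-search cell refl = refl

    -- Here v is the unread part of x, and k is how much the clock may still grow before a search
    -- must succeed. A failed search lowers k and keeps v; reading a bit shortens v and keeps k,
    -- because the clock is not reset.
    waiting : ∀ v k u t → x ≡ u ++ v → bound ≤ length t + k → ∀ {o c} →
              Head (false , t , u , q) (length u) o c → Stops c
    decided : ∀ v k u t → x ≡ u ++ v → bound ≤ length t + k → ∀ {o c} →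
              Head (false , t , u , q) (length u) o c → Outcome bound u t → Stops c

    waiting v k u t e le h = decided v k u t e le h (outcome u v t e)

    decided v zero u t e le h (inj₁ (_ , early)) =
      ⊥-elim (early (≤-trans le (≤-reflexive (+-identityʳ (length t)))))
    decided v (suc k) u t e le h (inj₁ (f , _)) = stops-later h
      (round-search (cellBits (inputCell x (length u))) f)
      (waiting v k u (true ∷ t) e (≤-trans le (≤-reflexive (+-suc (length t) k))))
    decided [] k u t e le h (inj₂ ([] , l , f)) =
      stops-now h (cong length (sym (trans e (++-identityʳ u))))
        (round-search (cellBits (inputCell x (length u))) f)
    -- The listed string is a proper prefix of x; prefix-freeness excludes this too, so the machine
    -- does not stop too early.
    decided (b ∷ v) k u t e le h (inj₂ ([] , l , f)) =
      ⊥-elim (no-extension u b v (subst S (++-identityʳ u) (Equivalence.to (enumerates _) l))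
                                 (subst S e Sx))
    decided [] k u t e le h (inj₂ (d ∷ s , l , f)) =
      ⊥-elim (no-extension u d s (subst S (trans e (++-identityʳ u)) Sx)
                                 (Equivalence.to (enumerates _) l))
    decided (b ∷ v) k u t e le {o} h (inj₂ (d ∷ s , l , f)) =
      -- Two rounds are needed: the head moves at the end of the first, and only the second one sees
      -- the new cell.
      stops-later h (round-search (cellBits (inputCell x (length u))) f) λ h′ →
      stops-later h′ (cong (λ c → false , false , false , false , false , t , u ++ c , q) cell) λ h″ →
      waiting v k (u ∷ʳ b) t (trans e (sym (++-assoc u [ b ] v))) le
        (subst (λ n → Head (false , t , u ∷ʳ b , q) n o _)
               (sym (trans (length-++ u) (+-comm (length u) 1))) h″)
      where
      cell : cellBits (inputCell x (suc (length u))) ≡ b ∷ []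
      cell = cong cellBits (trans (cong (λ y → inputCell y (suc (length u))) e) (cell-after u (b ∷ v)))

    stopsAt : StopsAt stopper x
    stopsAt =
      let c , r , h = starts (loaded q) x q refl
          d , p , z = waiting x bound [] [] refl (≤-reflexive refl) h
      in d , r ◅◅ p , z

-- Listing the strings at which a machine stops

markTy : Ty
markTy = bool ⊗ bool

outMark : Bool → Bool → Maybe (Maybe Bool)
outMark true  b     = just (just b)
outMark false true  = just nothing
outMark false false = nothing

-- A round writes at most one symbol, so a string to be listed waits in a queue of output marks,
-- closed by the mark of the separator.
queueOf : BitString → List ⟦ markTy ⟧
queueOf x = map (true ,_) x ++ (false , true) ∷ []

text : BitString → List (Maybe Bool)
text x = map just x ++ nothing ∷ []

emitted : List (Maybe Bool) → List ⟦ markTy ⟧ → List (Maybe Bool)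
emitted = foldl (λ { o (e , b) → appendedTo (outMark e b) o })

emitted-queueOf : ∀ o x → emitted o (queueOf x) ≡ o ++ text x
emitted-queueOf o []      = refl
emitted-queueOf o (b ∷ x) = trans (emitted-queueOf (o ∷ʳ just b) x) (++-assoc o (just b ∷ []) (text x))

emitted-++ : ∀ o m → ∃[ z ] emitted o m ≡ o ++ z
emitted-++ o []                = [] , sym (++-identityʳ o)
emitted-++ o ((e , b) ∷ m) with emitted-++ (appendedTo (outMark e b) o) m | grow (outMark e b)
  where
  grow : ∀ g → ∃[ z ] appendedTo g o ≡ o ++ z
  grow nothing  = [] , sym (++-identityʳ o)
  grow (just g) = g ∷ [] , refl
... | z , p | y , r = y ++ z , trans p (trans (cong (_++ z) r) (++-assoc o y z))

terminated-text : ∀ v x r → terminated v (text x ++ r) ≡ (v ++ x) ∷ terminated [] r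
terminated-text v []      r = cong (_∷ terminated [] r) (sym (++-identityʳ v))
terminated-text v (b ∷ x) r =
  trans (terminated-text (v ∷ʳ b) x r) (cong (_∷ terminated [] r) (++-assoc v (b ∷ []) x))

terminated-texts : ∀ xs → terminated [] (concatMap text xs) ≡ xs
terminated-texts []       = refl
terminated-texts (x ∷ xs) =
  trans (terminated-text [] x (concatMap text xs)) (cong (x ∷_) (terminated-texts xs))

chopTy : Ty
chopTy = bool ⊗ bits ⊗ list markTy

chopStep : ⟦ chopTy ⟧ → ⟦ chopTy ⟧
chopStep (ok , r , m) = caseList r (false , r , m) (λ b r′ → ok , r′ , m ++ (true , b) ∷ [])

chopStepC : Computable chopTy chopTy chopStep
chopStepC = caseC (fstC (sndC idC)) (litC false ,C sndC idC)
  (fstC outerC ,C tailC ,C (sndC (sndC outerC) ++C (litC true ,C headC) ∷C litC []))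

closeChop : ⟦ chopTy ⟧ → List ⟦ markTy ⟧
closeChop (ok , _ , m) = if ok then m ++ (false , true) ∷ [] else []

closeChopC : Computable chopTy (list markTy) closeChop
closeChopC = ifC (fstC idC) (sndC (sndC idC) ++C litC ((false , true) ∷ [])) (litC [])

-- There are no marks if w is shorter than p.
chop : BitString × BitString → List ⟦ markTy ⟧
chop (w , p) = closeChop (foldl (λ z _ → chopStep z) (true , w , []) p)

chopC : Computable (bits ⊗ bits) (list markTy) chop
chopC = closeChopC ∘C foldC (sndC idC) (litC true ,C fstC idC ,C litC []) (chopStepC ∘C stateC)

chop-failed : ∀ n m → proj₁ (foldl (λ z _ → chopStep z) (false , [] , m) (replicate n true)) ≡ false
chop-failed zero    m = refl
chop-failed (suc n) m = chop-failed n m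

chop-exact : ∀ u v m → foldl (λ z _ → chopStep z) (true , u ++ v , m) (replicate (length u) true)
                       ≡ (true , v , m ++ map (true ,_) u)
chop-exact []      v m = cong (λ m → true , v , m) (sym (++-identityʳ m))
chop-exact (b ∷ u) v m = trans (chop-exact u v (m ++ (true , b) ∷ []))
  (cong (λ m → true , v , m) (++-assoc m ((true , b) ∷ []) (map (true ,_) u)))

split-at : ∀ (w : BitString) n →
  (∃[ u ] ∃[ v ] w ≡ u ++ v × length u ≡ n) ⊎
  (∀ m → proj₁ (foldl (λ z _ → chopStep z) (true , w , m) (replicate n true)) ≡ false)
split-at w       zero    = inj₁ ([] , w , refl , refl)
split-at []      (suc n) = inj₂ (chop-failed n)
split-at (b ∷ w) (suc n) with split-at w n
... | inj₁ (u , v , e , l) = inj₁ (b ∷ u , v , cong (b ∷_) e , cong suc l)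
... | inj₂ p               = inj₂ (λ m → p (m ++ (true , b) ∷ []))

chop-prefix : ∀ u v → chop (u ++ v , replicate (length u) true) ≡ queueOf u
chop-prefix u v = cong closeChop (chop-exact u v [])

-- The machine may have halted beyond the end of w. Then its position names no prefix of w, and
-- nothing may be listed.
chop-sound : ∀ w n → chop (w , replicate n true) ≡ []
  ⊎ ∃[ u ] ∃[ v ] w ≡ u ++ v × length u ≡ n × chop (w , replicate n true) ≡ queueOf u
chop-sound w n with split-at w n
... | inj₁ (u , v , refl , refl) = inj₂ (u , v , refl , refl , chop-prefix u v)
... | inj₂ p = inj₁ (closed (foldl (λ z _ → chopStep z) (true , w , []) (replicate n true)) (p []))
  where
  closed : ∀ z → proj₁ z ≡ false → closeChop z ≡ []
  closed (false , _) e = refl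

enumTy : Ty
enumTy = list markTy ⊗ list bits ⊗ bits

module Stopping (M : Stopper) where

  open Run M
  open Bounded M

  -- By locality the halting run on u is also a halting run on `u ++ v`. Halting configurations are
  -- unique, so its position equals both lengths.
  stops-prefix : ∀ u v → StopsAt M u → StopsAt M (u ++ v) → v ≡ []
  stops-prefix u v (c , r , h , p) (d , s , k , q) =
    empty v (trans (sym q) (trans (cong position (sym c≡d)) p))
    where
    agree : ∀ i → i ≤ length u → inputCell u i ≡ inputCell (u ++ v) i
    agree = inputCell-++ u v

    c≡d : c ≡ d
    c≡d = halted-unique (path-local agree r (≤-reflexive p))
      (trans (sym (decision-local c (agree (position c) (≤-reflexive p)))) h) s k

    empty : ∀ v → length (u ++ v) ≡ length u → v ≡ []
    empty []      e = refl
    empty (b ∷ v) e with +-cancelˡ-≡ (length u) (suc (length v)) 0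
                           (trans (sym (length-++ u)) (trans e (sym (+-identityʳ (length u)))))
    ... | ()

  stops-on : ∀ u v {c} → Reachable (u ++ v) c → Halted (u ++ v) c → position c ≡ length u → StopsAt M u
  stops-on u v {c} r h p = c , path-local agree r (≤-reflexive p) ,
    trans (sym (decision-local c (agree (position c) (≤-reflexive p)))) h , p
    where
    agree : ∀ i → i ≤ length u → inputCell (u ++ v) i ≡ inputCell u i
    agree i le = sym (inputCell-++ u v i le)

  runFor-stops : ∀ {x} → StopsAt M x → ∃[ n ] (∀ v t → n ≤ length t → ∃[ c ]
                 runFor (x ++ v) t ≡ (true , c) × position c ≡ length x)
  runFor-stops {x} (c , r , h , p) with runFrom-halts r h
  ... | n , q = n , λ v t le →
    c , q (x ++ v) t (λ i l → inputCell-++ x v i (≤-trans l (≤-reflexive p))) le , p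

module Listing (U : Decompressor) where

  open Decoding U
  open Interpreter outBit outBitC using () renaming (runCode to runStopper; runCodeC to runStopperC)

  chosen : BitString × Bool × Conf → List ⟦ markTy ⟧
  chosen (w , h , _ , p , _) = if h then chop (w , p) else []

  chosenC : Computable (bits ⊗ bool ⊗ confTy) (list markTy) chosen
  chosenC = ifC (fstC (sndC idC)) (chopC ∘C (fstC idC ,C fstC (sndC (sndC (sndC idC))))) (litC [])

  opaque
    stopped : BitString × BitString → List ⟦ markTy ⟧
    stopped (w , y) = chosen (w , runStopper (y , w , w))

    stoppedC : Computable (bits ⊗ bits) (list markTy) stopped
    stoppedC = chosenC ∘C (fstC idC ,C runStopperC ∘C (sndC idC ,C fstC idC ,C fstC idC))

    stopped-run : ∀ M w → stopped (w , stopperCode M) ≡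
      (let (h , c) = Bounded.runFor M w w in
       if h then chop (w , replicate (Run.position c) true) else [])
    stopped-run M w = cong (λ z → chosen (w , z))
      (Simulation.runCode-image ⊥-elim outBit outBitC (λ ()) M w w)

  listed : BitString × BitString → List ⟦ markTy ⟧
  listed (q , w) = caseList (decoded (q , w)) [] (λ y _ → stopped (w , y))

  listedC : Computable (bits ⊗ bits) (list markTy) listed
  listedC = caseC decodedC (litC []) (stoppedC ∘C (sndC outerC ,C headC))

  -- The queue ws makes a breadth-first search through all strings. Children arise by prepending a
  -- bit, so the parent of a string is its tail, which suits the induction in `processes`.
  enumRound : BitString × ⟦ enumTy ⟧ → ⟦ orderTy enumTy ⟧
  enumRound (_ , m , ws , q) = caseList m
    (caseList ws (false , false , false , false , [] , [] , q) (λ w ws →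
      false , false , false , false , listed (q , w) , ws ++ (false ∷ w) ∷ (true ∷ w) ∷ [] , q))
    (λ (e , b) m → false , false , e , b , m , ws , q)

  enumRoundC : Computable (bits ⊗ enumTy) (orderTy enumTy) enumRound
  enumRoundC = caseC (fstC (sndC idC))
    (caseC (fstC (sndC (sndC idC)))
      (litC false ,C litC false ,C litC false ,C litC false ,C litC [] ,C litC [] ,C sndC (sndC (sndC idC)))
      (litC false ,C litC false ,C litC false ,C litC false ,C listedC ∘C (sndC (sndC (sndC outerC)) ,C headC)
        ,C (tailC ++C (litC false ∷C headC) ∷C (litC true ∷C headC) ∷C litC [])
        ,C sndC (sndC (sndC outerC))))
    (litC false ,C litC false ,C fstC headC ,C sndC headC ,C tailC ,C sndC (sndC outerC))

  module _ (M : Stopper) (q : BitString) (D : Decompresses U q (stopperCode M)) where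

    open Stopping M
    open Run M
    open Bounded M

    Listed : BitString → List ⟦ markTy ⟧ → Set
    Listed w m = m ≡ [] ⊎ ∃[ u ] StopsAt M u × m ≡ queueOf u

    stopped-sound : ∀ w → Listed w (stopped (w , stopperCode M))
    stopped-sound w = subst (Listed w) (sym (stopped-run M w))
      (byFlag (proj₁ (runFor w w)) (runFor-halted w w))
      where
      c = proj₂ (runFor w w)

      byChop : Halted w c → chop (w , replicate (position c) true) ≡ []
        ⊎ ∃[ u ] ∃[ v ] w ≡ u ++ v × length u ≡ position c
                      × chop (w , replicate (position c) true) ≡ queueOf u →
        Listed w (chop (w , replicate (position c) true))
      byChop h (inj₁ e) = inj₁ e
      byChop h (inj₂ (u , v , e , l , f)) = inj₂ (u , stops-on u v
        (subst (λ w → Reachable w c) e (runFrom-path w (false , initial) w))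
        (subst (λ w → Halted w c) e h) (sym l) , f)

      byFlag : ∀ h → (h ≡ true → Halted w c) →
               Listed w (if h then chop (w , replicate (position c) true) else [])
      byFlag false h = inj₁ refl
      byFlag true  h = byChop (h refl) (chop-sound w (position c))

    listed-sound : ∀ w → Listed w (listed (q , w))
    listed-sound w = byDecoding (decoded-sound D w)
      where
      byDecoding : decoded (q , w) ≡ [] ⊎ decoded (q , w) ≡ stopperCode M ∷ [] → Listed w (listed (q , w))
      byDecoding (inj₁ e) = inj₁ (cong (λ l → caseList l [] (λ y _ → stopped (w , y))) e)
      byDecoding (inj₂ e) = subst (Listed w)
        (sym (cong (λ l → caseList l [] (λ y _ → stopped (w , y))) e)) (stopped-sound w)

    listed-complete : ∀ {x} → StopsAt M x → ∃[ w ] listed (q , w) ≡ queueOf x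
    listed-complete {x} s = w , trans
      (cong (λ l → caseList l [] (λ y _ → stopped (w , y)))
            (proj₂ (decoded-complete D) w (≤-trans (m≤m⊔n n n′) long)))
      (trans (stopped-run M w) (run (proj₂ (runFor-stops s) v w (≤-trans (m≤n⊔m n n′) long))))
      where
      n  = proj₁ (decoded-complete D)
      n′ = proj₁ (runFor-stops s)
      -- The length of w is also the clock for both simulations, so x is padded until that length
      -- suffices; `M` stops before reading the padding.
      v = replicate (n ⊔ n′) false
      w = x ++ v

      long : n ⊔ n′ ≤ length w
      long = ≤-trans (m≤n+m (n ⊔ n′) (length x))
        (≤-reflexive (sym (trans (length-++ x) (cong (length x +_) (length-replicate (n ⊔ n′))))))

      run : ∃[ c ] runFor w w ≡ (true , c) × position c ≡ length x →
        (if proj₁ (runFor w w) then chop (w , replicate (position (proj₂ (runFor w w))) true) else [])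
          ≡ queueOf x
      run (c , e , p) = trans
        (cong (λ z → if proj₁ z then chop (w , replicate (position (proj₂ z)) true) else []) e)
        (trans (cong (λ n → chop (w , replicate n true)) p) (chop-prefix x v))

-- From a stopping machine to an enumerator

prefix-split : ∀ {u v : BitString} → Prefix _≡_ u v → ∃[ z ] v ≡ u ++ z
prefix-split []         = _ , refl
prefix-split (refl ∷ p) with prefix-split p
... | z , e = z , cong (_ ∷_) e

module Lister (U : Decompressor)
  (R : Computable (bits ⊗ enumTy) (orderTy enumTy) (Listing.enumRound U)) where

  open Listing U

  program : Program (Maybe Bool)
  program .Program.S      = enumTy
  program .Program.output = outMark
  program .Program.init   = ⟨ lit [] , ⟨ lit ([] ∷ []) , idn ⟩ ⟩
  program .Program.round  = term R

  open Hardwired program using (machine; AtHead; starts; continue; head-written; plus→star)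

  module _ (M : Stopper) (q : BitString) (D : Decompresses U q (stopperCode M)) where

    enumerator : Enumerator
    enumerator = machine (loaded q)

    open Run enumerator

    Head : ⟦ enumTy ⟧ → ℕ → List (Maybe Bool) → Config → Set
    Head = AtHead (loaded q) []

    Step⁺ : Config → Config → Set
    Step⁺ c d = ∃[ e ] Step [] c e × Star (Step []) e d

    star : ∀ {c d} → Step⁺ c d → Star (Step []) c d
    star = plus→star (loaded q) []

    -- Everything written or queued is a list of complete strings.
    Sound : List (Maybe Bool) → List ⟦ markTy ⟧ → Set
    Sound o m = ∃[ xs ] emitted o m ≡ concatMap text xs × (∀ {x} → x ∈ xs → StopsAt M x)

    data Invariant (c : Config) : Set where
      invariant : ∀ m ws i o → Head (m , ws , q) i o c → Sound o m → Invariant c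

    round-step : ∀ {s i o c e b s′} → Head s i o c →
      enumRound (cellBits (inputCell [] i) , s) ≡ (false , false , e , b , s′) →
      ∃[ d ] Step⁺ c d × Head s′ i (appendedTo (outMark e b) o) d
    round-step h eq = continue (loaded q) [] h (trans (correct R _) eq)

    sound-listed : ∀ w o → Sound o [] → Sound o (listed (q , w))
    sound-listed w o (xs , e , stops) = byCase (listed-sound M q D w)
      where
      byCase : Listed M q D w (listed (q , w)) → Sound o (listed (q , w))
      byCase (inj₁ f) = xs , trans (cong (emitted o) f) e , stops
      byCase (inj₂ (u , s , f)) = xs ++ u ∷ [] ,
        trans (cong (emitted o) f) (trans (emitted-queueOf o u)
          (trans (cong (_++ text u) e)
            (trans (cong (concatMap text xs ++_) (sym (++-identityʳ (text u))))
                   (sym (concatMap-++ text xs (u ∷ []))))))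
        , λ p → either (∈-++⁻ xs p)
        where
        either : ∀ {x} → x ∈ xs ⊎ x ∈ u ∷ [] → StopsAt M x
        either (inj₁ p)           = stops p
        either (inj₂ (here refl)) = s

    invariant-next : ∀ {c} → Invariant c → ∃[ d ] Step⁺ c d × Invariant d
    invariant-next (invariant [] [] i o h s) =
      let d , p , h′ = round-step h refl in d , p , invariant _ _ _ _ h′ s
    invariant-next (invariant [] (w ∷ ws) i o h s) =
      let d , p , h′ = round-step h refl in d , p , invariant _ _ _ _ h′ (sound-listed w o s)
    invariant-next (invariant ((e , b) ∷ m) ws i o h s) =
      let d , p , h′ = round-step h refl in d , p , invariant _ _ _ _ h′ s

    -- The configuration c may lie in the middle of a round. Following the run to the next loop head
    -- only lengthens the output, so x is still listed there, and the invariant applies.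
    lists-sound : ∀ {x} → Lists enumerator x → StopsAt M x
    lists-sound {x} (c , r , p) =
      let a , r₀ , h₀ = starts (loaded q) [] q refl
          d , r₁ , i  = Bounded.reaches-invariant enumerator Invariant invariant-next r r₀
                          (invariant [] _ 0 [] h₀ ([] , refl , λ ()))
      in listed-at i (Bounded.path-written enumerator r₁)
      where
      listed-at : ∀ {d} → Invariant d → ∃[ z ] written d ≡ written c ++ z → StopsAt M x
      listed-at {d} (invariant m ws i o h (xs , e , stops)) (z , f) =
        let y , g = emitted-++ o m in
        stops (subst (x ∈_) (trans (cong (terminated []) (trans (sym g) e)) (terminated-texts xs))
          (∈-terminated-++ [] o y (subst (λ w → x ∈ terminated [] w)
            (trans (sym f) (head-written (loaded q) [] h))
            (∈-terminated-++ [] (written c) z p))))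

    Idle : List BitString → List (Maybe Bool) → Config → Set
    Idle ws o c = (∃[ i ] Head ([] , ws , q) i o c) × Sound o []

    drain : ∀ m {ws i o c} → Head (m , ws , q) i o c → Sound o m →
            ∃[ d ] Star (Step []) c d × Idle ws (emitted o m) d
    drain []            h s = _ , ε , (_ , h) , s
    drain ((e , b) ∷ m) h s =
      let d , p , h′ = round-step h refl
          d′ , r , z = drain m h′ s
      in d′ , star p ◅◅ r , z

    process : ∀ {w ws o c} → Idle (w ∷ ws) o c →
      ∃[ d ] Star (Step []) c d
           × Idle (ws ++ (false ∷ w) ∷ (true ∷ w) ∷ []) (emitted o (listed (q , w))) d
    process {w} {ws} {o} ((i , h) , s) =
      let d , p , h′ = round-step h refl
          d′ , r , z = drain (listed (q , w)) h′ (sound-listed w o s)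
      in d′ , star p ◅◅ r , z

    Processes : Config → BitString → Set
    Processes c w = ∃[ ws ] ∃[ o ] ∃[ d ] Star (Step []) c d × Idle (w ∷ ws) o d

    processes-after : ∀ {c d w} → Star (Step []) c d → Processes d w → Processes c w
    processes-after r (ws , o , e , p , z) = ws , o , e , r ◅◅ p , z

    -- New strings join at the rear, so those ahead of w are used up one by one.
    bring : ∀ us {w vs o c} → Idle (us ++ w ∷ vs) o c → Processes c w
    bring []       z = _ , _ , _ , ε , z
    bring (u ∷ us) {w} {vs} z =
      let d , r , z′ = process z
      in processes-after r (bring us (subst (λ l → Idle l _ d) (++-assoc us (w ∷ vs) _) z′))

    processes : ∀ w → Processes initial w
    processes [] =
      let c , r , h = starts (loaded q) [] q refl
      in [] , [] , c , r , (0 , h) , [] , refl , λ ()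
    processes (b ∷ w) =
      let ws , o , c , r , z = processes w
          d , p , z′         = process z
      in processes-after (r ◅◅ p) (child b ws z′)
      where
      child : ∀ b ws {o d} → Idle (ws ++ (false ∷ w) ∷ (true ∷ w) ∷ []) o d → Processes d (b ∷ w)
      child false ws z = bring ws z
      child true  ws z = bring (ws ++ (false ∷ w) ∷ [])
        (subst (λ l → Idle l _ _) (sym (++-assoc ws _ _)) z)

    lists-complete : ∀ {x} → StopsAt M x → Lists enumerator x
    lists-complete {x} s =
      let w , l              = listed-complete M q D s
          ws , o , c , r , z = processes w
          d , p , (_ , h) , _ = process z
      in d , r ◅◅ p , written-at (proj₂ z) l h
      where
      written-at : ∀ {o i w ws d} → Sound o [] → listed (q , w) ≡ queueOf x →
        Head ([] , ws , q) i (emitted o (listed (q , w))) d → x ∈ terminated [] (written d)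
      written-at {o} (xs , e , _) l h =
        subst (λ t → x ∈ terminated [] t)
          (sym (trans (head-written (loaded q) [] h) (trans (cong (emitted o) l)
            (trans (emitted-queueOf o x) (trans (cong (_++ text x) e)
              (trans (cong (concatMap text xs ++_) (sym (++-identityʳ (text x))))
                     (sym (concatMap-++ text xs (x ∷ [])))))))))
          (subst (x ∈_) (sym (terminated-texts (xs ++ x ∷ []))) (∈-++⁺ʳ xs (here refl)))

    enumerates-prefixFree : ∀ {x} → StopsAt M x →
      ∃[ S ] Enumerates enumerator S × PrefixFree S × S x
    enumerates-prefixFree s =
      Lists enumerator , (λ _ → mk⇔ id id) , prefixFree , lists-complete s
      where
      prefixFree : PrefixFree (Lists enumerator)
      prefixFree u v p r (pre , distinct) =
        let z , e = prefix-split pre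
            empty = Stopping.stops-prefix M u z (lists-sound p) (subst (StopsAt M) e (lists-sound r))
        in distinct (sym (trans e (trans (cong (u ++_) empty) (++-identityʳ u))))

-- The two bounds

-- Strong induction: if n is not minimal, a smaller member takes its place. Since P need not be
-- decidable, the choice between the two is available only under a double negation.
¬¬-minimum : ∀ {ℓ} (P : Pred ℕ ℓ) n → P n → ¬ ¬ (∃[ k ] IsMinimum P k × k ≤ n)
¬¬-minimum {ℓ} P = <-rec (λ n → P n → ¬ ¬ (∃[ k ] IsMinimum P k × k ≤ n)) least
  where
  least : ∀ n → (∀ {m} → m < n → P m → ¬ ¬ (∃[ k ] IsMinimum P k × k ≤ m)) →
          P n → ¬ ¬ (∃[ k ] IsMinimum P k × k ≤ n)
  least n below p none = none (n , (p , minimal) , ≤-refl)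
    where
    minimal : ∀ m → P m → n ≤ m
    minimal m q with n ≤? m
    ... | yes n≤m = n≤m
    ... | no  n≰m = ⊥-elim (below (≰⇒> n≰m) q λ (k , least , k≤m) →
                              none (k , least , ≤-trans k≤m (<⇒≤ (≰⇒> n≰m))))

-- Membership in P asks for the exact complexity of y, whereas only a short description q is at
-- hand; `¬¬-minimum` supplies the missing number while the decidable goal n ≤ k is being refuted.
minimum-bound : ∀ {ℓ} {P : Pred ℕ ℓ} {U y n k} → (∀ m → P m → n ≤ m) →
  (∀ {m} → PlainComplexity U y m → P m) →
  ∃[ q ] Decompresses U q y × length q ≤ k → n ≤ k
minimum-bound {U = U} {y} {n} {k} minimal member (q , d , le) =
  decidable-stable (n ≤? k) λ n≰k →
    ¬¬-minimum (λ n → ∃[ p ] Decompresses U p y × length p ≡ n) (length q) (q , d , refl)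
      λ (m , least , m≤) → n≰k (≤-trans (minimal m (member least)) (≤-trans m≤ le))

computable-cost : ∀ {U} → Optimal U → ∀ {f} → Computable bits bits f →
  ∃[ c ] (∀ q → ∃[ q′ ] Decompresses U q′ (f q) × length q′ ≤ length q + c)
computable-cost optimal {f} F =
  let c , bound = optimal (Copier.decompressor f (copierRoundC F))
  in c , λ q → bound q (f q) (Copier.decompresses f (copierRoundC F) q)

enumeration≤stopping : ∀ {U} → Optimal U →
  Computable (bits ⊗ enumTy) (orderTy enumTy) (Listing.enumRound U) →
  ∃[ c ] (∀ x m n → StoppingComplexity U x m → PrefixFreeEnumerationComplexity U x n → n ≤ m + c)
enumeration≤stopping {U} optimal R = proj₁ cost , bound
  where
  module L = Lister U R

  cost = computable-cost optimal
    (Coding.hardwiredC (maybeCode [_]) (Hardwired.driver L.program))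

  bound : ∀ x m n → StoppingComplexity U x m → PrefixFreeEnumerationComplexity U x n → n ≤ m + proj₁ cost
  -- The string p describes `M` and has length m; it is the one that is hardwired into the
  -- enumerator.
  bound x m n ((M , stops , (p , d , refl) , _) , _) (_ , minimal) =
    minimum-bound minimal
      (λ complexity → L.enumerator M p d , L.enumerates-prefixFree M p d stops , complexity)
      (proj₂ cost p)

stopping≤enumeration : ∀ {U} → Optimal U →
  Computable (bits ⊗ readerTy) (orderTy readerTy) (Decoding.readerRound U) →
  ∃[ c ] (∀ x m n → StoppingComplexity U x m → PrefixFreeEnumerationComplexity U x n → m ≤ n + c)
stopping≤enumeration {U} optimal R = proj₁ cost , bound
  where
  module R = Reader U R

  cost = computable-cost optimal (Coding.hardwiredC ⊥-elim (Hardwired.driver R.program))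

  bound : ∀ x m n → StoppingComplexity U x m → PrefixFreeEnumerationComplexity U x n → m ≤ n + proj₁ cost
  bound x m n (_ , minimal) ((E , (S , enumerates , prefixFree , Sx) , (p , d , refl) , _) , _) =
    minimum-bound minimal
      (λ complexity → R.stopper E p d S enumerates prefixFree x Sx ,
                      R.stopsAt E p d S enumerates prefixFree x Sx , complexity)
      (proj₂ cost p)

∣-∣≤ : ∀ {m n c} → m ≤ n + c → n ≤ m + c → ∣ m - n ∣ ≤ c
∣-∣≤ {m} {n} {c} p q with ≤-total m n
... | inj₁ m≤n = subst (_≤ c) (sym (m≤n⇒∣m-n∣≡n∸m m≤n)) (m≤n+o⇒m∸n≤o n m q)
... | inj₂ n≤m = subst (_≤ c) (sym (m≤n⇒∣n-m∣≡n∸m n≤m)) (m≤n+o⇒m∸n≤o m n p)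

theorem1 : (U : Decompressor) → Optimal U →
    ∃[ c ] (∀ (x : BitString) (m n : ℕ) →
    StoppingComplexity U x m →
    PrefixFreeEnumerationComplexity U x n →
    ∣ m - n ∣ ≤ c)
theorem1 U optimal =
  let c₁ , enumeration≤ = enumeration≤stopping optimal (Listing.enumRoundC U)
      c₂ , stopping≤    = stopping≤enumeration optimal (Decoding.readerRoundC U)
  in c₁ ⊔ c₂ , λ x m n s e →
     ∣-∣≤ (≤-trans (stopping≤ x m n s e) (+-monoʳ-≤ n (m≤n⊔m c₁ c₂)))
          (≤-trans (enumeration≤ x m n s e) (+-monoʳ-≤ m (m≤m⊔n c₁ c₂)))
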